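{- Let $G$ be a finite simple graph that contains no induced $P_5$ and no induced gem. Then $\chi(G) \le \lceil \frac{\Delta(G)+\omega(G)+1}{2}\rceil$. Moreover, this bound is tight: for every positive integer $q$ there exists a ($P_5$, gem)-free graph $G$ with $\omega(G)=2q$ and $\chi(G)=\lceil \frac{\Delta(G)+\omega(G)+1}{2}\rceil$.
   Context: $P_5$ is the path on five vertices. The gem is the graph consisting of a path $P_4$ together with one further vertex adjacent to all four vertices of the $P_4$. $\chi(G)$ is the chromatic number, $\omega(G)$ the clique number, and $\Delta(G)$ the maximum degree of $G$. -}

module Defs where

open import Data.Nat using (ℕ; zero; suc; _+_; _≤_; _<_; _⊔_; ⌈_/2⌉)
open import Data.Nat.Properties using (_≟_)
open import Data.Bool using (Bool; true; false; if_then_else_; _∨_)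
open import Data.Fin using (Fin; toℕ)
open import Data.Fin.Subset using (Subset; _∈_; ∣_∣)
open import Data.List using (List; foldr; map)
open import Data.Nat.ListAction using (sum)
open import Data.List using (allFin)
open import Data.Product using (Σ; _×_; ∃; ∃-syntax)
open import Relation.Binary.PropositionalEquality using (_≡_; _≢_)
open import Relation.Nullary using (¬_; does)
open import Function.Definitions using (Injective)

record Graph (n : ℕ) : Set where
  field
    adj   : Fin n → Fin n → Bool
    sym   : ∀ u v → adj u v ≡ adj v u
    irref : ∀ v → adj v v ≡ false

open Graph public

Adj : ∀ {n} → Graph n → Fin n → Fin n → Set
Adj G u v = adj G u v ≡ true

degree : ∀ {n} → Graph n → Fin n → ℕ
degree {n} G v = sum (map (λ u → if adj G v u then 1 else 0) (allFin n))

maxDegree : ∀ {n} → Graph n → ℕ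
maxDegree {n} G = foldr _⊔_ 0 (map (degree G) (allFin n))

IsClique : ∀ {n} → Graph n → Subset n → Set
IsClique G S = ∀ u v → u ∈ S → v ∈ S → u ≢ v → Adj G u v

IsCliqueNumber : ∀ {n} → Graph n → ℕ → Set
IsCliqueNumber {n} G w =
  (∃[ S ] (IsClique G S × ∣ S ∣ ≡ w)) × (∀ (S : Subset n) → IsClique G S → ∣ S ∣ ≤ w)

ProperColouring : ∀ {n} → Graph n → (k : ℕ) → (Fin n → Fin k) → Set
ProperColouring G k c = ∀ u v → Adj G u v → c u ≢ c v

Colourable : ∀ {n} → Graph n → ℕ → Set
Colourable {n} G k = ∃[ c ] ProperColouring G k c

IsChromaticNumber : ∀ {n} → Graph n → ℕ → Set
IsChromaticNumber G k = Colourable G k × (∀ j → j < k → ¬ Colourable G j)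

ContainsInduced : ∀ {n m} → Graph n → (Fin m → Fin m → Bool) → Set
ContainsInduced {n} {m} G h =
  ∃[ f ] (Injective _≡_ _≡_ f × (∀ i j → adj G (f i) (f j) ≡ h i j))

P5adj : Fin 5 → Fin 5 → Bool
P5adj i j = does (suc (toℕ i) ≟ toℕ j) ∨ does (suc (toℕ j) ≟ toℕ i)

-- gem: P4 on vertices 0-1-2-3 plus vertex 4 adjacent to 0,1,2,3
gemAdj : Fin 5 → Fin 5 → Bool
gemAdj i j =
  if does (toℕ i ≟ toℕ j) then false
  else if does (toℕ i ≟ 4) ∨ does (toℕ j ≟ 4) then true
  else P5adj i j

P5GemFree : ∀ {n} → Graph n → Set
P5GemFree G = ¬ ContainsInduced G P5adj × ¬ ContainsInduced G gemAdj

bound : ℕ → ℕ → ℕ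
bound Δ ω = ⌈ Δ + ω + 1 /2⌉

{-# OPTIONS --safe #-}
module Submission where

-- Let k be the bound.  By induction G − v has a k-colouring, and we show that it can be changed so
-- as to extend to v.  Suppose not.  Every colour occurs among the neighbours of v, and as
-- deg v ≤ 2k − ω − 1, at least ω + 1 colours occur there exactly once; so two neighbours x, y with
-- such colours are non-adjacent, and a Kempe chain puts v, x, y on an induced C₅.  Let A and B be
-- the sets of non-neighbours of v adjacent to just y, respectively just x: they are complete to
-- each other.  The hole can be moved from v to y, from there to the vertices of A coloured like x,
-- and these can be given another colour unless one of them has all relevant colours around it in A;
-- likewise for x and B.  If both moves are blocked and the colouring is chosen minimal, a greedy
-- argument in the P₄-free sets A and B turns the ω + 1 colours into a clique.  Vertices adjacent to
-- both x and y disturb this only if v has a special place in an 8-vertex graph, which is avoided by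
-- the choice of v.  Tightness: complete graphs.

open import Defs
open import Data.Bool using (Bool; true; false; if_then_else_; _∧_; _∨_; not; T)
open import Data.Bool.Properties using (T-∧; T-∨)
import Data.Bool.Properties as Bool
open import Data.Empty using (⊥; ⊥-elim)
open import Data.Fin using (Fin; zero; suc; #_; toℕ; fromℕ<; inject≤; punchIn; punchOut; splitAt; join; finToFun; funToFin)
open import Data.Fin.Properties using (_≟_; any?; all?; toℕ<n; toℕ-fromℕ<; toℕ-injective; suc-injective; punchIn-injective; punchIn-punchOut; finToFun-funToFin; injective⇒≤; inject≤-injective; join-splitAt)
open import Data.Fin.Subset using (Subset; _∈_; ∣_∣; ⊤)
open import Data.Fin.Subset.Properties using (∣⊤∣≡n; ∣p∣≤n)
open import Data.List using (List; []; _∷_; _++_; concat; tabulate; filter; allFin; foldr)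
open import Data.List.Membership.Propositional.Properties using (∈-allFin; ∈-filter⁺)
open import Data.List.Properties using (map-tabulate)
open import Data.List.Relation.Unary.All using (All; []; _∷_)
import Data.List.Relation.Unary.All as All
import Data.List.Relation.Unary.All.Properties as All
open import Data.Nat using (ℕ; zero; suc; _+_; _*_; _≤_; _<_; _⊔_; _≡ᵇ_; ⌈_/2⌉; ⌊_/2⌋; z≤n; s≤s)
open import Data.Nat.Induction using (<-wellFounded)
open import Data.Nat.ListAction using (sum)
import Data.Nat.Properties as ℕ
open import Data.Product using (Σ; _×_; _,_; ∃-syntax; proj₁; proj₂)
open import Data.Sum using (_⊎_; inj₁; inj₂; [_,_]′)
open import Data.Vec using (Vec; []; _∷_; lookup)
import Data.Vec as Vec
import Data.Vec.Properties as Vec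
open import Function using (_∘_; id; Equivalence; mk⇔)
open import Function.Definitions using (Injective)
open import Induction.WellFounded using (Acc; acc)
open import Relation.Binary.PropositionalEquality using (_≡_; _≢_; refl; trans; cong; cong₂; subst; ≢-sym)
import Relation.Binary.PropositionalEquality as ≡
open import Relation.Nullary using (¬_; Dec; yes; no; does)
open import Relation.Nullary.Decidable using (⌊_⌋; toWitness; from-yes; map′; _×-dec_; _⊎-dec_; _→-dec_; ¬?; dec-true; dec-false; does-⇔; decidable-stable)

-- Induced copies of small graphs

Pattern : ℕ → Set
Pattern m = Fin m → Fin m → Bool

Copy : ∀ {n m} → Graph n → Pattern m → (Fin m → Fin n) → Set
Copy G h f = ∀ i j → adj G (f i) (f j) ≡ h i j

TwinFree : ∀ {m} → Pattern m → Set
TwinFree h = ∀ i j → (∀ l → h i l ≡ h j l) → i ≡ j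

twinFree? : ∀ {m} (h : Pattern m) → Dec (TwinFree h)
twinFree? h = all? λ i → all? λ j → all? (λ l → h i l Bool.≟ h j l) →-dec (i ≟ j)

-- Two roles sent to the same vertex have equal rows in `h`; in a twin-free pattern they coincide,
-- so the copy is injective.
¬copy : ∀ {n m} (G : Graph n) {h : Pattern m} → TwinFree h → ¬ ContainsInduced G h →
        ∀ f → ¬ Copy G h f
¬copy G tf ¬h f copy = ¬h (f , injective , copy)
  where
  injective : ∀ {i j} → f i ≡ f j → i ≡ j
  injective {i} {j} eq = tf i j λ l →
    trans (≡.sym (copy i l)) (trans (cong (λ u → adj G u (f l)) eq) (copy j l))

-- Two 5-cycles 0-1-2-3-4 and 1-2-6-7-5 with the further edges 05, 06, 35, 36.
obstruction : Pattern 8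
obstruction i j = lookup (lookup
  ( (o ∷ I ∷ o ∷ o ∷ I ∷ I ∷ I ∷ o ∷ [])
  ∷ (I ∷ o ∷ I ∷ o ∷ o ∷ I ∷ o ∷ o ∷ [])
  ∷ (o ∷ I ∷ o ∷ I ∷ o ∷ o ∷ I ∷ o ∷ [])
  ∷ (o ∷ o ∷ I ∷ o ∷ I ∷ I ∷ I ∷ o ∷ [])
  ∷ (I ∷ o ∷ o ∷ I ∷ o ∷ o ∷ o ∷ o ∷ [])
  ∷ (I ∷ I ∷ o ∷ I ∷ o ∷ o ∷ o ∷ I ∷ [])
  ∷ (I ∷ o ∷ I ∷ I ∷ o ∷ o ∷ o ∷ I ∷ [])
  ∷ (o ∷ o ∷ o ∷ o ∷ o ∷ I ∷ I ∷ o ∷ [])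
  ∷ []) i) j
  where
  o I : Bool
  o = false
  I = true

-- Certificates for case analyses on adjacency

-- A refutation of a partially known graph: branch on the adjacency of two labels until an induced
-- P₅, gem or (rooted) obstruction shows up.  Labels may denote equal vertices: P₅ and the gem have
-- no twins, so their copies are automatically injective.
data Cert : Set where
  p5 gem : (a b c d e : ℕ) → Cert
  oct    : (a b c d e f g h : ℕ) → Cert
  split  : (i j : ℕ) → Cert → Cert → Cert

Fact : Set
Fact = ℕ × ℕ × Bool

infix 6 _∼_ _≀_
_∼_ _≀_ : ℕ → ℕ → Fact
i ∼ j = i , j , true
i ≀ j = i , j , false

known : List Fact → ℕ → ℕ → Bool → Bool
-- When the facts are used up, irreflexivity remains: a label is non-adjacent to itself.
known []                 i j b = (i ≡ᵇ j) ∧ not b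
known ((i′ , j′ , b′) ∷ Γ) i j b =
  (((i ≡ᵇ i′) ∧ (j ≡ᵇ j′)) ∨ ((i ≡ᵇ j′) ∧ (j ≡ᵇ i′))) ∧ does (b Bool.≟ b′) ∨ known Γ i j b

knownCopy : ∀ {m} → List Fact → Pattern m → Vec ℕ m → Bool
knownCopy Γ h vs = ⌊ all? (λ i → all? λ j → known Γ (lookup vs i) (lookup vs j) (h i j) Bool.≟ true) ⌋

-- Obstructions count only if the flag is set, and only with label 0 in role 1.
check : Bool → List Fact → Cert → Bool
check r Γ (p5 a b c d e)        = knownCopy Γ P5adj (a ∷ b ∷ c ∷ d ∷ e ∷ [])
check r Γ (gem a b c d e)       = knownCopy Γ gemAdj (a ∷ b ∷ c ∷ d ∷ e ∷ [])
check r Γ (oct a b c d e f g h) =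
  r ∧ (b ≡ᵇ 0) ∧ knownCopy Γ obstruction (a ∷ b ∷ c ∷ d ∷ e ∷ f ∷ g ∷ h ∷ [])
check r Γ (split i j c d)       = check r (i ∼ j ∷ Γ) c ∧ check r (i ≀ j ∷ Γ) d

T-split : ∀ {x y} → T (x ∧ y) → T x × T y
T-split = Equivalence.to T-∧

module Refutation {n} (G : Graph n) (free : P5GemFree G) (ρ : ℕ → Fin n) where

  Holds : Fact → Set
  Holds (i , j , b) = adj G (ρ i) (ρ j) ≡ b

  known-sound : ∀ {Γ} → All Holds Γ → ∀ i j b → T (known Γ i j b) → adj G (ρ i) (ρ j) ≡ b
  known-sound [] i j b t with T-split {i ≡ᵇ j} t
  known-sound [] i j false t | i≡j , _ rewrite ℕ.≡ᵇ⇒≡ i j i≡j = irref G (ρ j)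
  known-sound {(i′ , j′ , b′) ∷ Γ} (p ∷ ps) i j b t
    with Equivalence.to (T-∨ {(((i ≡ᵇ i′) ∧ (j ≡ᵇ j′)) ∨ ((i ≡ᵇ j′) ∧ (j ≡ᵇ i′))) ∧ does (b Bool.≟ b′)}) t
  ... | inj₂ t′ = known-sound ps i j b t′
  ... | inj₁ t′ with T-split {((i ≡ᵇ i′) ∧ (j ≡ᵇ j′)) ∨ ((i ≡ᵇ j′) ∧ (j ≡ᵇ i′))} t′
  ...   | match , same with b Bool.≟ b′
  ...     | no _ = ⊥-elim same
  ...     | yes refl with Equivalence.to (T-∨ {(i ≡ᵇ i′) ∧ (j ≡ᵇ j′)}) match
  ...       | inj₁ m with T-split {i ≡ᵇ i′} m
  ...         | ei , ej rewrite ℕ.≡ᵇ⇒≡ i i′ ei | ℕ.≡ᵇ⇒≡ j j′ ej = p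
  known-sound {(i′ , j′ , b′) ∷ Γ} (p ∷ ps) i j b t | inj₁ t′ | match , same | yes refl | inj₂ m
    with T-split {i ≡ᵇ j′} m
  ... | ei , ej rewrite ℕ.≡ᵇ⇒≡ i j′ ei | ℕ.≡ᵇ⇒≡ j i′ ej = trans (sym G (ρ j′) (ρ i′)) p

  knownCopy-sound : ∀ {m Γ} (h : Pattern m) vs → All Holds Γ → T (knownCopy Γ h vs) →
                    Copy G h (ρ ∘ lookup vs)
  knownCopy-sound h vs ps t i j = known-sound ps _ _ _ (subst T (≡.sym (toWitness t i j)) _)

  -- Recursion on the certificate: a `split` follows the branch that `G` realises, and a leaf would
  -- be a forbidden copy. The flag `r` admits obstructions as leaves, which are excluded only with
  -- `ρ 0` in role 1.
  sound : ∀ r → (r ≡ true → ∀ f → f (# 1) ≡ ρ 0 → ¬ Copy G obstruction f) →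
          ∀ Γ → All Holds Γ → ∀ c → T (check r Γ c) → ⊥
  sound r no-oct Γ ps (p5 a b c d e) t =
    ¬copy G (from-yes (twinFree? P5adj)) (proj₁ free) _
      (knownCopy-sound P5adj (a ∷ b ∷ c ∷ d ∷ e ∷ []) ps t)
  sound r no-oct Γ ps (gem a b c d e) t =
    ¬copy G (from-yes (twinFree? gemAdj)) (proj₂ free) _
      (knownCopy-sound gemAdj (a ∷ b ∷ c ∷ d ∷ e ∷ []) ps t)
  sound true no-oct Γ ps (oct a b c d e f g h) t with T-split {b ≡ᵇ 0} t
  ... | b≡0 , t′ = no-oct refl _ (cong ρ (ℕ.≡ᵇ⇒≡ b 0 b≡0))
    (knownCopy-sound obstruction (a ∷ b ∷ c ∷ d ∷ e ∷ f ∷ g ∷ h ∷ []) ps t′)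
  sound r no-oct Γ ps (split i j c d) t with T-split {check r (i ∼ j ∷ Γ) c} t
  ... | tc , td with adj G (ρ i) (ρ j) in eq
  ...   | true  = sound r no-oct _ (eq ∷ ps) c tc
  ...   | false = sound r no-oct _ (eq ∷ ps) d td

-- Two obstructions sharing a vertex

nth : ∀ {A : Set} → A → List A → ℕ → A
nth d []       _       = d
nth d (x ∷ xs) zero    = x
nth d (x ∷ xs) (suc i) = nth d xs i

nth-left : ∀ {A : Set} {m} d (f : Fin m → A) ys i → nth d (tabulate f ++ ys) (toℕ i) ≡ f i
nth-left d f ys zero    = refl
nth-left d f ys (suc i) = nth-left d (f ∘ suc) ys i

nth-right : ∀ {A : Set} {m} d (f : Fin m → A) ys i → nth d (tabulate f ++ ys) (m + i) ≡ nth d ys i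
nth-right {m = zero}  d f ys i = refl
nth-right {m = suc m} d f ys i = nth-right d (f ∘ suc) ys i

copyFact : (Fin 8 → ℕ) → Fin 8 → Fin 8 → Fact
copyFact ℓ i j = ℓ i , ℓ j , obstruction i j

copyFacts : (Fin 8 → ℕ) → List Fact
copyFacts ℓ = concat (tabulate λ i → tabulate (copyFact ℓ i))

-- Labels for a second copy whose vertex in role r is the vertex in role 0 of the first copy.
glued : Fin 8 → Fin 8 → ℕ
glued r j = if does (j ≟ r) then 0 else 8 + toℕ j

module Roles {n} (G : Graph n) (free : P5GemFree G) {f g : Fin 8 → Fin n}
  (cf : Copy G obstruction f) (cg : Copy G obstruction g) where

  -- If the two vertices agreed, the copies could be glued there. The certificate refutes the glued
  -- graph whatever the edges between the copies are, and whichever further vertices coincide.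
  role₀-excludes : ∀ r c → T (check false (copyFacts toℕ ++ copyFacts (glued r)) c) → g r ≢ f (# 0)
  role₀-excludes r c t eq = sound false (λ ()) _
      (All.++⁺ (holds toℕ first cf) (holds (glued r) second cg)) c t
    where
    ρ : ℕ → Fin n
    -- Labels 0 to 7 read `f` and labels 8 to 15 read `g`; no label in use reaches the default.
    ρ = nth (f (# 0)) (tabulate f ++ tabulate g ++ [])
    open Refutation G free ρ
    holds : ∀ ℓ {h} → (∀ i → ρ (ℓ i) ≡ h i) → Copy G obstruction h → All Holds (copyFacts ℓ)
    holds ℓ eh ch = All.concat⁺ (All.tabulate⁺ {f = λ i → tabulate (copyFact ℓ i)} λ i →
      All.tabulate⁺ {f = copyFact ℓ i} λ j → trans (cong₂ (adj G) (eh i) (eh j)) (ch i j))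
    first : ∀ i → ρ (toℕ i) ≡ f i
    first = nth-left (f (# 0)) f (tabulate g ++ [])
    second : ∀ j → ρ (glued r j) ≡ g j
    second j with j ≟ r
    ... | yes refl = ≡.sym eq
    ... | no _     = trans (nth-right (f (# 0)) f (tabulate g ++ []) (toℕ j)) (nth-left (f (# 0)) g [] j)

  role₀-not-role₁ : g (# 1) ≢ f (# 0)
  role₀-not-role₁ = role₀-excludes (# 1) (
    split 12 6 (split 11 6 (split 10 6 (gem 0 10 11 12 6) (split 14 6 (gem 10 14 6 12 11) (p5 14 10
      0 6 12))) (split 14 6 (split 10 6 (gem 0 6 14 11 10) (split 15 6 (p5 15 6 0 10 11) (split 13
      6 (split 11 2 (split 11 5 (split 13 5 (gem 11 5 0 6 13) (split 13 1 (gem 6 13 1 5 0) (split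
      13 2 (gem 11 2 6 0 13) (p5 13 6 2 1 5)))) (p5 11 2 6 0 5)) (split 11 5 (p5 11 5 0 6 2) (split
      10 2 (split 12 5 (split 14 5 (split 10 5 (gem 0 5 14 11 10) (split 10 7 (split 12 2 (split 10
      1 (gem 2 10 0 5 1) (split 10 4 (p5 4 10 2 1 5) (split 12 4 (split 12 1 (gem 2 12 5 0 1)
      (split 12 7 (p5 12 7 10 0 1) (p5 12 4 0 10 7))) (p5 12 2 10 0 4)))) (p5 12 5 0 10 2)) (p5 10
      2 6 7 5))) (p5 14 11 12 5 0)) (p5 11 12 6 0 5)) (p5 11 10 0 6 2)))) (p5 13 15 14 6 12)))) (p5
      14 11 12 6 0))) (split 12 7 (split 12 1 (split 12 5 (gem 7 12 1 0 5) (split 12 4 (split 12 2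
      (p5 12 2 6 0 5) (p5 12 4 0 6 2)) (p5 12 7 5 0 4))) (p5 12 7 6 0 1)) (split 12 1 (p5 12 1 0 6
      7) (split 12 3 (p5 12 3 6 0 1) (split 12 4 (p5 12 4 0 6 7) (split 12 2 (p5 12 2 1 0 4) (split
      12 5 (p5 12 5 0 6 2) (split 11 6 (split 11 1 (split 11 4 (split 11 5 (split 11 3 (gem 3 11 1
      0 5) (split 11 2 (gem 2 11 5 0 1) (p5 12 11 1 2 3))) (p5 12 11 4 0 5)) (p5 12 11 1 0 4)) (p5
      12 11 6 0 1)) (split 11 5 (p5 12 11 5 0 6) (split 11 3 (p5 12 11 3 5 0) (split 13 6 (split 11
      2 (p5 11 2 3 5 0) (split 13 2 (split 13 5 (gem 5 0 6 2 13) (p5 5 0 13 11 12)) (p5 2 6 13 11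
      12))) (p5 6 0 13 11 12)))))))))))) _

  role₀-not-role₄ : g (# 4) ≢ f (# 0)
  role₀-not-role₄ = role₀-excludes (# 4) (
    split 14 5 (split 15 5 (split 11 5 (gem 0 11 14 15 5) (split 10 5 (gem 11 10 5 15 14) (p5 10 11
      0 5 15))) (split 13 5 (split 15 4 (split 15 7 (split 15 2 (p5 2 15 4 0 5) (split 15 3 (split
      15 6 (gem 4 15 6 2 3) (p5 15 4 0 6 2)) (p5 15 7 5 3 2))) (p5 15 4 0 5 7)) (split 13 4 (split
      14 4 (split 15 1 (split 14 1 (gem 15 14 5 0 1) (split 13 1 (gem 15 13 5 0 1) (split 9 1
      (split 9 4 (split 10 4 (gem 14 10 9 13 4) (split 10 1 (p5 10 1 0 4 13) (p5 10 14 15 1 0)))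
      (p5 9 1 0 4 14)) (p5 9 13 15 1 0)))) (split 14 1 (split 14 2 (gem 2 14 5 0 1) (split 15 2 (p5
      15 2 1 0 4) (split 14 3 (gem 3 14 1 0 5) (split 15 3 (p5 15 3 2 1 0) (p5 15 14 4 3 2))))) (p5
      15 14 4 0 1))) (p5 14 15 13 4 0)) (p5 15 13 5 0 4))) (p5 13 15 14 5 0))) (split 10 5 (split
      11 5 (gem 0 5 10 14 11) (split 15 5 (split 9 5 (p5 9 5 0 11 14) (split 8 5 (split 13 5 (gem 9
      13 5 0 8) (p5 13 9 10 5 0)) (p5 8 9 10 5 15))) (p5 15 14 10 5 0))) (split 8 5 (split 9 5 (p5
      0 5 9 10 14) (split 11 5 (split 13 5 (p5 5 13 9 10 14) (split 13 4 (split 8 4 (gem 13 4 0 5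
      8) (split 11 4 (gem 4 11 5 8 0) (split 9 4 (p5 4 9 8 5 11) (p5 9 13 4 0 5)))) (split 13 7 (p5
      13 7 5 0 4) (split 9 7 (p5 13 9 7 5 0) (split 10 7 (p5 9 10 7 5 0) (split 8 7 (split 8 4 (gem
      4 0 5 7 8) (split 11 4 (gem 4 11 5 8 0) (split 9 4 (p5 9 4 0 5 7) (p5 9 13 11 0 4)))) (p5 7 5
      8 9 10))))))) (p5 11 10 9 8 5))) (p5 5 0 8 14 10)))) _

-- Adjacency and forbidden induced subgraphs

module Adjacency {n} (G : Graph n) where

  infix 4 _~_ _≁_ _~?_ _≁?_
  _~_ _≁_ : Fin n → Fin n → Set
  u ~ w = adj G u w ≡ true
  u ≁ w = adj G u w ≡ false

  _~?_ : ∀ u w → Dec (u ~ w)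
  u ~? w = adj G u w Bool.≟ true

  _≁?_ : ∀ u w → Dec (u ≁ w)
  u ≁? w = adj G u w Bool.≟ false

  ~-sym : ∀ {u w} → u ~ w → w ~ u
  ~-sym {u} {w} = trans (sym G w u)

  ≁-sym : ∀ {u w} → u ≁ w → w ≁ u
  ≁-sym {u} {w} = trans (sym G w u)

  absurd : ∀ {u w} {A : Set} → u ~ w → u ≁ w → A
  absurd p q with () ← trans (≡.sym p) q

  ~-irrefl : ∀ {u w} → u ~ w → u ≢ w
  ~-irrefl p refl = absurd p (irref G _)

  adjacent? : ∀ u w → u ~ w ⊎ u ≁ w
  adjacent? u w with adj G u w
  ... | true  = inj₁ refl
  ... | false = inj₂ refl

  ¬~⇒≁ : ∀ {u w} → ¬ u ~ w → u ≁ w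
  ¬~⇒≁ {u} {w} ¬p with adjacent? u w
  ... | inj₁ p = ⊥-elim (¬p p)
  ... | inj₂ q = q

module Forbidden {n} (G : Graph n) (free : P5GemFree G) where
  open Adjacency G

  p5-free : ∀ {a b c d e} → a ~ b → b ~ c → c ~ d → d ~ e →
            a ≁ c → a ≁ d → a ≁ e → b ≁ d → b ≁ e → c ≁ e → ⊥
  p5-free {a} {b} {c} {d} {e} ab bc cd de ac ad ae bd be ce =
    sound false (λ ())
      (0 ∼ 1 ∷ 1 ∼ 2 ∷ 2 ∼ 3 ∷ 3 ∼ 4 ∷
               0 ≀ 2 ∷ 0 ≀ 3 ∷ 0 ≀ 4 ∷
               1 ≀ 3 ∷ 1 ≀ 4 ∷ 2 ≀ 4 ∷ [])
      (ab ∷ bc ∷ cd ∷ de ∷ ac ∷ ad ∷ ae ∷ bd ∷ be ∷ ce ∷ []) (p5 0 1 2 3 4) _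
    where open Refutation G free (nth a (a ∷ b ∷ c ∷ d ∷ e ∷ []))

  gem-free : ∀ {a b c d e} → a ~ b → b ~ c → c ~ d → a ≁ c → a ≁ d → b ≁ d →
             e ~ a → e ~ b → e ~ c → e ~ d → ⊥
  gem-free {a} {b} {c} {d} {e} ab bc cd ac ad bd ea eb ec ed =
    sound false (λ ())
      (0 ∼ 1 ∷ 1 ∼ 2 ∷ 2 ∼ 3 ∷
               0 ≀ 2 ∷ 0 ≀ 3 ∷ 1 ≀ 3 ∷
               4 ∼ 0 ∷ 4 ∼ 1 ∷ 4 ∼ 2 ∷ 4 ∼ 3 ∷ [])
      (ab ∷ bc ∷ cd ∷ ac ∷ ad ∷ bd ∷ ea ∷ eb ∷ ec ∷ ed ∷ []) (gem 0 1 2 3 4) _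
    where open Refutation G free (nth a (a ∷ b ∷ c ∷ d ∷ e ∷ []))

-- Kempe chains around an uncoloured vertex

-- The vertex v is uncoloured: φ v is a junk value.
module Hole {n k} (G : Graph n) (free : P5GemFree G) (uncolourable : ¬ Colourable G k)
  (v : Fin n) (no₁ : ∀ f → f (# 1) ≡ v → ¬ Copy G obstruction f)
  (φ : Fin n → Fin k) (proper : ∀ {u w} → u ≢ v → w ≢ v → Adj G u w → φ u ≢ φ w) where

  open Adjacency G
  open Forbidden G free

  V : Set
  V = Fin n

  same : ∀ {u w} → u ≢ v → w ≢ v → φ u ≡ φ w → u ≁ w
  same u≢v w≢v eq = ¬~⇒≁ λ u~w → proper u≢v w≢v u~w eq

  -- The colour may depend on a proof-carrying status of the vertex, so properness becomes a case
  -- analysis on pairs of statuses.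
  recolouring : (Status : V → Set) (status : ∀ u → Status u) (colour : ∀ {u} → Status u → Fin k) →
                (∀ {u w} → u ~ w → (s : Status u) (t : Status w) → colour s ≢ colour t) → ⊥
  recolouring Status status colour distinct =
    uncolourable ((λ u → colour (status u)) , λ u w u~w → distinct u~w (status u) (status w))

  near⇒≢ : ∀ {u} → v ~ u → u ≢ v
  near⇒≢ v~u = ≢-sym (~-irrefl v~u)

  record Unique (u : V) : Set where
    field
      near : v ~ u
      only : ∀ {w} → v ~ w → φ w ≡ φ u → w ≡ u
    ≢v : u ≢ v
    ≢v = near⇒≢ near

  open Unique

  -- Otherwise `v` itself could take the colour `c`.
  seen : ∀ c → ∃[ u ] (v ~ u × φ u ≡ c)
  seen c with any? (λ u → (v ~? u) ×-dec (φ u ≟ c))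
  ... | yes p = p
  ... | no ¬p = ⊥-elim (recolouring (λ u → Dec (u ≡ v)) (_≟ v) colour distinct)
    where
    colour : ∀ {u} → Dec (u ≡ v) → Fin k
    colour     (yes _) = c
    colour {u} (no  _) = φ u
    distinct : ∀ {u w} → u ~ w → (s : Dec (u ≡ v)) (t : Dec (w ≡ v)) → colour s ≢ colour t
    distinct u~w (yes refl) (yes refl) _  = ~-irrefl u~w refl
    distinct u~w (yes refl) (no _)     eq = ¬p (_ , u~w , ≡.sym eq)
    distinct u~w (no _)     (yes refl) eq = ¬p (_ , ~-sym u~w , eq)
    distinct u~w (no u≢v)   (no w≢v)   eq = proper u≢v w≢v u~w eq

  record Pair (x y : V) : Set where
    constructor pair
    field
      ux  : Unique x
      uy  : Unique y
      x≢y : x ≢ y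
      x≁y : x ≁ y
    a≢b : φ x ≢ φ y
    a≢b eq = x≢y (only uy (near ux) eq)

  flip : ∀ {x y} → Pair x y → Pair y x
  flip (pair ux uy x≢y x≁y) = pair uy ux (≢-sym x≢y) (≁-sym x≁y)

  -- For a `Pair`, the cycle `v x p q y` is an induced C₅ whose inner vertices `p` and `q` carry the
  -- colours of `y` and `x`.
  record Chain (x y : V) : Set where
    field
      p q : V
      p≢v : p ≢ v
      q≢v : q ≢ v
      φp  : φ p ≡ φ y
      φq  : φ q ≡ φ x
      v≁p : v ≁ p
      v≁q : v ≁ q
      x~p : x ~ p
      p~q : p ~ q
      q~y : q ~ y
      x≁q : x ≁ q
      p≁y : p ≁ y

  module Kempe {x y} (P : Pair x y) where
    open Pair P

    -- `Snd` and `Fst` explore the Kempe component of `x` for the colours `φ x` and `φ y`: `Snd` at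
    -- distance 1, `Fst` at distance 0 or 2.
    Snd : V → Set
    Snd u = u ≢ v × φ u ≡ φ y × x ~ u
    snd? : ∀ u → Dec (Snd u)
    snd? u = ¬? (u ≟ v) ×-dec ((φ u ≟ φ y) ×-dec (x ~? u))
    Fst : V → Set
    Fst u = u ≢ v × φ u ≡ φ x × (u ≡ x ⊎ ∃[ p ] (Snd p × p ~ u))
    fst? : ∀ u → Dec (Fst u)
    fst? u = ¬? (u ≟ v) ×-dec ((φ u ≟ φ x) ×-dec ((u ≟ x) ⊎-dec any? (λ p → snd? p ×-dec (p ~? u))))

    -- Swapping the colours φ x and φ y on Fst and Snd would free the colour φ x at v.
    ¬unlinked : ¬ (∀ q → Fst q → ¬ q ~ y)
    ¬unlinked unlinked = recolouring Status status colour distinct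
      where
      data Status (u : V) : Set where
        hole : u ≡ v → Status u
        fst  : Fst u → Status u
        snd  : Snd u → Status u
        out  : u ≢ v → ¬ Fst u → ¬ Snd u → Status u
      status : ∀ u → Status u
      status u with u ≟ v | fst? u | snd? u
      ... | yes e | _     | _     = hole e
      ... | no _  | yes f | _     = fst f
      ... | no _  | no _  | yes s = snd s
      ... | no ¬e | no ¬f | no ¬s = out ¬e ¬f ¬s
      colour : ∀ {u} → Status u → Fin k
      colour     (hole _)    = φ x
      colour     (fst _)     = φ y
      colour     (snd _)     = φ x
      colour {u} (out _ _ _) = φ u
      hole-snd : ∀ {w} → v ~ w → ¬ Snd w
      hole-snd v~w (_ , φw , x~w) = absurd (subst (x ~_) (only uy v~w φw) x~w) x≁y
      hole-out : ∀ {w} → v ~ w → w ≢ v → ¬ Fst w → φ x ≢ φ w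
      hole-out v~w w≢v ¬f eq = ¬f (w≢v , ≡.sym eq , inj₁ (only ux v~w (≡.sym eq)))
      fst-out : ∀ {u w} → u ~ w → Fst u → w ≢ v → ¬ Snd w → φ y ≢ φ w
      fst-out u~w (_ , _ , inj₁ refl) w≢v ¬s eq = ¬s (w≢v , ≡.sym eq , u~w)
      fst-out {u} {w} u~w fu@(u≢v , φu , inj₂ (p , (p≢v , φp , x~p) , p~u)) w≢v ¬s eq =
        -- The component ends at distance 2, since `v x p u w` would be an induced path.
        p5-free (near ux) x~p p~u u~w
          (¬~⇒≁ λ v~p → absurd (subst (x ~_) (only uy v~p φp) x~p) x≁y)
          (¬~⇒≁ λ v~u → absurd (subst (_~ w) (only ux v~u φu) u~w) x≁w)
          (¬~⇒≁ λ v~w → unlinked u fu (subst (u ~_) (only uy v~w (≡.sym eq)) u~w))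
          (same (≢v ux) u≢v (≡.sym φu)) x≁w (same p≢v w≢v (trans φp eq))
        where
        x≁w : x ≁ w
        x≁w = ¬~⇒≁ λ x~w → ¬s (w≢v , ≡.sym eq , x~w)
      snd-out : ∀ {u w} → u ~ w → Snd u → w ≢ v → ¬ Fst w → φ x ≢ φ w
      snd-out u~w s w≢v ¬f eq = ¬f (w≢v , ≡.sym eq , inj₂ (_ , s , u~w))
      distinct : ∀ {u w} → u ~ w → (s : Status u) (t : Status w) → colour s ≢ colour t
      distinct u~w (hole refl) (hole refl) _ = ~-irrefl u~w refl
      distinct u~w (hole _) (fst _) = a≢b
      distinct u~w (hole refl) (snd s) _ = hole-snd u~w s
      distinct u~w (hole refl) (out e f _) = hole-out u~w e f
      distinct u~w (fst _) (hole _) = ≢-sym a≢b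
      distinct u~w (fst (e , φu , _)) (fst (e′ , φw , _)) _ = proper e e′ u~w (trans φu (≡.sym φw))
      distinct u~w (fst _) (snd _) = ≢-sym a≢b
      distinct u~w (fst f) (out e _ s) = fst-out u~w f e s
      distinct u~w (snd s) (hole refl) _ = hole-snd (~-sym u~w) s
      distinct u~w (snd _) (fst _) = a≢b
      distinct u~w (snd (e , φu , _)) (snd (e′ , φw , _)) _ = proper e e′ u~w (trans φu (≡.sym φw))
      distinct u~w (snd s) (out e f _) = snd-out u~w s e f
      distinct u~w (out e f _) (hole refl) = ≢-sym (hole-out (~-sym u~w) e f)
      distinct u~w (out e _ s) (fst f) = ≢-sym (fst-out (~-sym u~w) f e s)
      distinct u~w (out e f _) (snd s) = ≢-sym (snd-out (~-sym u~w) s e f)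
      distinct u~w (out e _ _) (out e′ _ _) = proper e e′ u~w

    chain : Chain x y
    chain with any? (λ q → fst? q ×-dec (q ~? y))
    ... | no ¬found = ⊥-elim (¬unlinked λ q f q~y → ¬found (q , f , q~y))
    ... | yes (q , (q≢v , φq , inj₁ refl) , q~y) = absurd q~y x≁y
    ... | yes (q , (q≢v , φq , inj₂ (p , (p≢v , φp , x~p) , p~q)) , q~y) = record
      { p = p ; q = q ; p≢v = p≢v ; q≢v = q≢v ; φp = φp ; φq = φq
      ; v≁p = ¬~⇒≁ λ v~p → absurd (subst (x ~_) (only uy v~p φp) x~p) x≁y
      ; v≁q = ¬~⇒≁ λ v~q → absurd (subst (_~ y) (only ux v~q φq) q~y) x≁y
      ; x~p = x~p ; p~q = p~q ; q~y = q~y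
      ; x≁q = same (≢v ux) q≢v (≡.sym φq) ; p≁y = same p≢v (≢v uy) φp }

  open Kempe using () renaming (chain to kempe)

  -- Non-neighbours of the hole, sorted by their adjacency to a pair

  -- `Pvt x y` and `Pvt y x` are the sets A and B. `Com` has to exclude `v`, a non-neighbour of
  -- itself that is adjacent to both `x` and `y`.
  Pvt Com Non : V → V → V → Set
  Pvt x y w = v ≁ w × x ≁ w × y ~ w
  Com x y w = w ≢ v × v ≁ w × x ~ w × y ~ w
  Non x y w = v ≁ w × x ≁ w × y ≁ w

  pvt? : ∀ x y w → Dec (Pvt x y w)
  pvt? x y w = (v ≁? w) ×-dec ((x ≁? w) ×-dec (y ~? w))

  com? : ∀ x y w → Dec (Com x y w)
  com? x y w = ¬? (w ≟ v) ×-dec ((v ≁? w) ×-dec ((x ~? w) ×-dec (y ~? w)))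

  module _ {x y} (P : Pair x y) where
    open Pair P

    pvt≢v : ∀ {r} → Pvt x y r → r ≢ v
    pvt≢v (_ , x≁r , _) refl = absurd (~-sym (near ux)) x≁r

    -- Otherwise `p x v y r` would be an induced path.
    pvt-complete : ∀ {p r} → Pvt y x p → Pvt x y r → p ~ r
    pvt-complete {p} {r} (vp , yp , xp) (vr , xr , yr) with adjacent? p r
    ... | inj₁ p~r = p~r
    ... | inj₂ p≁r = ⊥-elim (p5-free (~-sym xp) (~-sym (near ux)) (near uy) yr
            (≁-sym vp) (≁-sym yp) p≁r x≁y xr vr)

    pvt-x : ∃[ q ] (Pvt x y q × φ q ≡ φ x)
    pvt-x = q , (v≁q , x≁q , ~-sym q~y) , φq
      where open Chain (kempe P)

    non-pvt : ∀ {t r} → Non x y t → Pvt x y r → t ≁ r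
    non-pvt (vt , xt , yt) (vr , xr , yr) = ¬~⇒≁ λ t~r → p5-free t~r (~-sym yr) (~-sym (near uy))
      (near ux) (≁-sym yt) (≁-sym vt) (≁-sym xt) (≁-sym vr) (≁-sym xr) (≁-sym x≁y)

    -- Otherwise `v x s r r′` would be an induced path. Hence `s` sees all or nothing of each
    -- component of `Pvt x y`.
    com-unmixed : ∀ {s r r′} → Com x y s → Pvt x y r → Pvt x y r′ → r ~ r′ → s ~ r → s ~ r′
    com-unmixed {s} {r} {r′} (_ , vs , xs , ys) (vr , xr , yr) (vr′ , xr′ , yr′) r~r′ s~r
      with adjacent? s r′
    ... | inj₁ s~r′ = s~r′
    ... | inj₂ s≁r′ = ⊥-elim (p5-free (near ux) xs s~r r~r′ vs vr vr′ xr xr′ s≁r′)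

    -- Otherwise `s` would be the hub of a gem over the path `x p r y`.
    com-one-side : ∀ {s p r} → Com x y s → Pvt y x p → Pvt x y r → s ~ r → s ≁ p
    com-one-side (_ , vs , xs , ys) Pp@(vp , yp , xp) Pr@(vr , xr , yr) s~r = ¬~⇒≁ λ s~p →
      gem-free xp (pvt-complete Pp Pr) (~-sym yr) xr x≁y (≁-sym yp)
        (~-sym xs) s~p s~r (~-sym ys)

    pvt-P4-free : ∀ {a b c d} → Pvt x y a → Pvt x y b → Pvt x y c → Pvt x y d →
                  a ~ b → b ~ c → c ~ d → a ≁ c → a ≁ d → b ≁ d → ⊥
    pvt-P4-free (_ , _ , ya) (_ , _ , yb) (_ , _ , yc) (_ , _ , yd) ab bc cd ac ad bd =
      gem-free ab bc cd ac ad bd ya yb yc yd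

    -- The Kempe chains of the three non-adjacent pairs are put together at `v`; every completion of
    -- this ten-label graph contains a P₅ or a gem.
    no-triple : ∀ {u} → Unique u → u ≢ x → u ≢ y → x ≁ u → y ≁ u → ⊥
    no-triple {u} uu u≢x u≢y x≁u y≁u = Refutation.sound G free
        (nth v (v ∷ x ∷ y ∷ A.p ∷ A.q ∷ u ∷ B.p ∷ B.q ∷ C.p ∷ C.q ∷ [])) false (λ ()) facts
        (near ux ∷ near uy ∷ A.x~p ∷ A.p~q ∷ A.q~y ∷ near uu ∷
         B.x~p ∷ B.p~q ∷ B.q~y ∷ C.x~p ∷ C.p~q ∷ C.q~y ∷
         x≁y ∷ A.v≁p ∷ A.v≁q ∷ A.x≁q ∷ A.p≁y ∷ x≁u ∷ y≁u ∷
         B.v≁p ∷ B.v≁q ∷ B.p≁y ∷ B.x≁q ∷ C.v≁p ∷ C.v≁q ∷ C.p≁y ∷ C.x≁q ∷ [])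
        cert _
      where
      module A = Chain (kempe P)
      module B = Chain (kempe (pair ux uu (≢-sym u≢x) x≁u))
      module C = Chain (kempe (pair uy uu (≢-sym u≢y) y≁u))
      facts : List Fact
      facts = 0 ∼ 1 ∷ 0 ∼ 2 ∷ 1 ∼ 3 ∷ 3 ∼ 4 ∷ 4 ∼ 2 ∷
        0 ∼ 5 ∷ 1 ∼ 6 ∷ 6 ∼ 7 ∷ 7 ∼ 5 ∷
        2 ∼ 8 ∷ 8 ∼ 9 ∷ 9 ∼ 5 ∷
        1 ≀ 2 ∷ 0 ≀ 3 ∷ 0 ≀ 4 ∷ 1 ≀ 4 ∷ 3 ≀ 2 ∷
        1 ≀ 5 ∷ 2 ≀ 5 ∷ 0 ≀ 6 ∷ 0 ≀ 7 ∷ 6 ≀ 5 ∷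
        1 ≀ 7 ∷ 0 ≀ 8 ∷ 0 ≀ 9 ∷ 8 ≀ 5 ∷ 2 ≀ 9 ∷ []
      cert : Cert
      cert =
        split 5 3 (split 8 3 (split 6 2 (split 6 3 (split 6 4 (gem 2 4 3 1 6) (split 7 3 (gem 5 7 6
          1 3) (split 7 4 (p5 7 4 3 1 0) (split 5 4 (p5 5 4 2 6 1) (split 7 2 (p5 7 2 0 1 3) (p5 7
          5 0 2 4)))))) (p5 6 2 0 5 3)) (split 7 2 (split 7 3 (split 8 6 (p5 6 8 2 0 5) (split 8 7
          (gem 2 8 3 5 7) (split 8 1 (p5 8 1 0 5 7) (p5 8 2 0 1 6)))) (p5 7 2 0 1 3)) (p5 7 6 1 0
          2))) (p5 8 2 0 5 3)) (split 5 4 (split 8 3 (p5 3 8 2 0 5) (split 9 3 (p5 3 9 5 0 2)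
          (split 8 1 (split 8 4 (split 9 1 (split 9 4 (gem 1 9 4 2 8) (p5 9 1 3 4 2)) (p5 9 5 0 1
          3)) (p5 8 1 3 4 5)) (p5 8 2 0 1 3)))) (p5 5 0 2 4 3))

    module _ {u} (uu : Unique u) (u≢y : u ≢ y) (x~u : x ~ u) (y≁u : y ≁ u) where

      private
        module A = Chain (kempe P)
        module B = Chain (kempe (pair uu uy u≢y (≁-sym y≁u)))

        pp : A.p ≁ B.p
        pp = same A.p≢v B.p≢v (trans A.φp (≡.sym B.φp))

      -- The witness lies on the Kempe chain between `u` and `y`. Were it adjacent to `x`, the two
      -- chains would yield a P₅, a gem, or an obstruction with `v` in role 1.
      pvt-colour : ∃[ q ] (Pvt x y q × φ q ≡ φ u)
      pvt-colour = B.q , (B.v≁q , ¬~⇒≁ x≁q , ~-sym B.q~y) , B.φq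
        where
        x≁q : ¬ x ~ B.q
        x≁q x~q = Refutation.sound G free
          (nth v (v ∷ x ∷ y ∷ A.p ∷ A.q ∷ u ∷ B.p ∷ B.q ∷ [])) true (λ _ → no₁)
          (0 ∼ 1 ∷ 0 ∼ 2 ∷ 1 ∼ 3 ∷ 3 ∼ 4 ∷ 4 ∼ 2 ∷
           0 ∼ 5 ∷ 1 ∼ 5 ∷ 5 ∼ 6 ∷ 6 ∼ 7 ∷ 7 ∼ 2 ∷
           1 ∼ 7 ∷ 1 ≀ 2 ∷ 0 ≀ 3 ∷ 0 ≀ 4 ∷ 1 ≀ 4 ∷
           3 ≀ 2 ∷ 2 ≀ 5 ∷ 0 ≀ 6 ∷ 0 ≀ 7 ∷ 5 ≀ 7 ∷
           6 ≀ 2 ∷ 3 ≀ 6 ∷ [])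
          (near ux ∷ near uy ∷ A.x~p ∷ A.p~q ∷ A.q~y ∷ near uu ∷ x~u ∷ B.x~p ∷ B.p~q ∷ B.q~y ∷
           x~q ∷ x≁y ∷ A.v≁p ∷ A.v≁q ∷ A.x≁q ∷ A.p≁y ∷ y≁u ∷ B.v≁p ∷ B.v≁q ∷ B.x≁q ∷
           B.p≁y ∷ pp ∷ [])
          cert _
          where
          cert : Cert
          cert =
            split 6 1 (gem 7 6 5 0 1) (split 6 4 (p5 6 4 2 0 1) (split 5 4 (split 5 3 (gem 4 3 1 0
              5) (split 7 3 (p5 3 7 2 0 5) (split 7 4 (oct 1 0 2 4 3 5 7 6) (p5 7 6 5 4 3)))) (p5 6
              5 0 2 4)))

      -- Here `r` closes a 5-cycle with `v`, `x`, `y` and the first chain's `p`; an edge to `u`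
      -- again leads to a P₅, a gem, or an obstruction with `v` in role 1.
      pvt-anticomplete : ∀ {r} → Pvt x y r → u ≁ r
      pvt-anticomplete {r} R@(v≁r , x≁r , y~r) = ¬~⇒≁ λ u~r → Refutation.sound G free
          (nth v (v ∷ x ∷ y ∷ A.p ∷ r ∷ u ∷ B.p ∷ B.q ∷ [])) true (λ _ → no₁)
          (0 ∼ 1 ∷ 0 ∼ 2 ∷ 1 ∼ 3 ∷ 3 ∼ 4 ∷ 2 ∼ 4 ∷
           0 ∼ 5 ∷ 1 ∼ 5 ∷ 5 ∼ 6 ∷ 6 ∼ 7 ∷ 7 ∼ 2 ∷
           5 ∼ 4 ∷ 1 ≀ 2 ∷ 0 ≀ 3 ∷ 0 ≀ 4 ∷ 1 ≀ 4 ∷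
           3 ≀ 2 ∷ 2 ≀ 5 ∷ 0 ≀ 6 ∷ 0 ≀ 7 ∷ 5 ≀ 7 ∷
           6 ≀ 2 ∷ 3 ≀ 6 ∷ [])
          (near ux ∷ near uy ∷ A.x~p ∷ pvt-complete (A.v≁p , ≁-sym A.p≁y , A.x~p) R ∷ y~r ∷
           near uu ∷ x~u ∷ B.x~p ∷ B.p~q ∷ B.q~y ∷
           u~r ∷ x≁y ∷ A.v≁p ∷ v≁r ∷ x≁r ∷ A.p≁y ∷ y≁u ∷ B.v≁p ∷ B.v≁q ∷ B.x≁q ∷
           B.p≁y ∷ pp ∷ [])
          cert _
        where
        cert : Cert
        cert =
          split 5 3 (gem 4 3 1 0 5) (split 7 3 (p5 3 7 2 0 5) (split 7 1 (split 6 1 (gem 7 6 5 0 1)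
            (split 6 4 (p5 6 4 2 0 1) (split 7 4 (oct 1 0 2 4 3 5 7 6) (p5 7 6 5 4 3)))) (p5 7 2 0
            1 3)))

  -- Case analysis on how `u` sees `x` and `y`. As a consequence, a colour missing from `Pvt y x` is
  -- never blocked at `r` by a `Unique` neighbour of `v`.
  unique-pvt : ∀ {x y u r} → Pair x y → Unique u → Pvt x y r → u ~ r → ∃[ p ] (Pvt y x p × φ p ≡ φ u)
  unique-pvt {x} {y} {u} P uu R@(v≁r , x≁r , y~r) u~r
    with u ≟ x | u ≟ y | adjacent? x u | adjacent? y u
  ... | yes refl | _        | _        | _        = absurd u~r x≁r
  ... | no _     | yes refl | _        | _        = pvt-x (flip P)
  ... | no _     | no _     | inj₁ x~u | inj₁ y~u =
    ⊥-elim (gem-free (~-sym (near ux)) (near uy) y~r x≁y x≁r v≁r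
      (~-sym x~u) (~-sym (near uu)) (~-sym y~u) u~r)
    where open Pair P
  ... | no _     | no u≢y   | inj₁ x~u | inj₂ y≁u =
    absurd u~r (pvt-anticomplete P uu u≢y x~u y≁u R)
  ... | no u≢x   | no _     | inj₂ x≁u | inj₁ y~u = pvt-colour (flip P) uu u≢x y~u x≁u
  ... | no u≢x   | no u≢y   | inj₂ x≁u | inj₂ y≁u = ⊥-elim (no-triple P uu u≢x u≢y x≁u y≁u)

-- Sums and maxima over finite types

∑ : ∀ {n} → (Fin n → ℕ) → ℕ
∑ f = sum (tabulate f)

∑-mono-≤ : ∀ {n} {f g : Fin n → ℕ} → (∀ i → f i ≤ g i) → ∑ f ≤ ∑ g
∑-mono-≤ {zero}  f≤g = z≤n
∑-mono-≤ {suc n} f≤g = ℕ.+-mono-≤ (f≤g zero) (∑-mono-≤ (f≤g ∘ suc))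

∑-mono-< : ∀ {n} {f g : Fin n → ℕ} → (∀ i → f i ≤ g i) → ∀ j → f j < g j → ∑ f < ∑ g
∑-mono-< f≤g zero    lt = ℕ.+-mono-<-≤ lt (∑-mono-≤ (f≤g ∘ suc))
∑-mono-< f≤g (suc j) lt = ℕ.+-mono-≤-< (f≤g zero) (∑-mono-< (f≤g ∘ suc) j lt)

indicator : {A : Set} → Dec A → ℕ
indicator (yes _) = 1
indicator (no _)  = 0

indicator-mono : {A B : Set} (A? : Dec A) (B? : Dec B) → (A → B) → indicator A? ≤ indicator B?
indicator-mono (yes a) (yes _) _ = ℕ.≤-refl
indicator-mono (yes a) (no ¬b) f = ⊥-elim (¬b (f a))
indicator-mono (no _)  _       _ = z≤n

indicator-< : {A B : Set} (A? : Dec A) (B? : Dec B) → ¬ A → B → indicator A? < indicator B?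
indicator-< (yes a) _       ¬a _ = ⊥-elim (¬a a)
indicator-< (no _)  (yes _) _  _ = s≤s z≤n
indicator-< (no _)  (no ¬b) _  b = ⊥-elim (¬b b)

argmax : ∀ {n} {P : Fin n → Set} → (∀ i → Dec (P i)) → (key : Fin n → ℕ) →
         (∀ i → ¬ P i) ⊎ ∃[ i ] (P i × ∀ j → P j → key j ≤ key i)
argmax {zero}  P? key = inj₁ λ ()
argmax {suc n} P? key with P? zero | argmax (P? ∘ suc) (key ∘ suc)
... | no ¬p | inj₁ none = inj₁ λ { zero → ¬p ; (suc i) → none i }
... | no ¬p | inj₂ (i , pᵢ , max) =
  inj₂ (suc i , pᵢ , λ { zero p → ⊥-elim (¬p p) ; (suc j) → max j })
... | yes p | inj₁ none =
  inj₂ (zero , p , λ { zero _ → ℕ.≤-refl ; (suc j) pⱼ → ⊥-elim (none j pⱼ) })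
... | yes p | inj₂ (i , pᵢ , max) with ℕ.≤-total (key zero) (key (suc i))
...   | inj₁ le = inj₂ (suc i , pᵢ , λ { zero _ → le ; (suc j) → max j })
...   | inj₂ ge =
  inj₂ (zero , p , λ { zero _ → ℕ.≤-refl ; (suc j) pⱼ → ℕ.≤-trans (max j pⱼ) ge })

-- Moving the hole into A or B

module Extension {n k ω} (G : Graph n) (free : P5GemFree G) (uncolourable : ¬ Colourable G k)
  (cliques : ∀ (f : Fin (suc ω) → Fin n) → ¬ (∀ i j → i ≢ j → Adj G (f i) (f j)))
  (v : Fin n) (no₁ : ∀ f → f (# 1) ≡ v → ¬ Copy G obstruction f)
  (no₄ : ∀ f → f (# 4) ≡ v → ¬ Copy G obstruction f)
  (φ : Fin n → Fin k) (proper : ∀ {u w} → u ≢ v → w ≢ v → Adj G u w → φ u ≢ φ w)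
  (minimal : ∀ {w c} → w ≢ v → toℕ c < toℕ (φ w) → ∃[ h ] (h ≢ v × Adj G w h × φ h ≡ c))
  (u : Fin (suc ω) → Fin n) (φu-injective : ∀ {i j} → φ (u i) ≡ φ (u j) → i ≡ j)
  (unique : ∀ i → Hole.Unique G free uncolourable v no₁ φ proper (u i))
  where

  open Hole G free uncolourable v no₁ φ proper
  open Adjacency G
  open Forbidden G free
  open Unique

  -- These are the `ω + 1` colours selected among those that occur exactly once around `v`.
  Solo : Fin k → Set
  Solo c = ∃[ i ] (φ (u i) ≡ c)

  solo? : ∀ c → Dec (Solo c)
  solo? c = any? λ i → φ (u i) ≟ c

  solo-unique : ∀ {c h} → Solo c → v ~ h → φ h ≡ c → Unique h
  solo-unique (i , refl) v~h φh = subst Unique (≡.sym (only (unique i) v~h φh)) (unique i)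

  Col : V → V → Fin k → Set
  Col x y c = ∃[ r ] (Pvt x y r × φ r ≡ c)

  col? : ∀ x y c → Dec (Col x y c)
  col? x y c = any? λ r → pvt? x y r ×-dec (φ r ≟ c)

  col-disjoint : ∀ {x y c} → Pair x y → Col x y c → ¬ Col y x c
  col-disjoint P (r , R , φr) (p , Q , φp) =
    proper (pvt≢v (flip P) Q) (pvt≢v P R) (pvt-complete P Q R) (trans φp (≡.sym φr))

  data Place (x y h : V) : Set where
    pvt : Pvt x y h → Place x y h
    pvtᵒ : Pvt y x h → Place x y h
    com : Com x y h → Place x y h
    non : Non x y h → Place x y h

  place : ∀ x y {h} → h ≢ v → v ≁ h → Place x y h
  place x y {h} h≢v v≁h with adjacent? x h | adjacent? y h
  ... | inj₁ xh | inj₁ yh = com (h≢v , v≁h , xh , yh)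
  ... | inj₁ xh | inj₂ yh = pvtᵒ (v≁h , yh , xh)
  ... | inj₂ xh | inj₁ yh = pvt (v≁h , xh , yh)
  ... | inj₂ xh | inj₂ yh = non (v≁h , xh , yh)

  Mono : V → V → V → Set
  Mono x y w = Pvt x y w × φ w ≡ φ x

  mono? : ∀ x y w → Dec (Mono x y w)
  mono? x y w = pvt? x y w ×-dec (φ w ≟ φ x)

  -- When `w` takes the colour `c`, these conditions leave only neighbours in `Com` as possible
  -- conflicts. The old colour of `x` is barred because `y` receives it.
  record Free (x y w : V) (c : Fin k) : Set where
    constructor mkFree
    field
      solo     : Solo c
      ¬opposite : ¬ Col y x c
      ≢old     : c ≢ φ x
      ¬beside  : ∀ {r} → Pvt x y r → w ~ r → φ r ≢ c

  open Free

  Moved : (x y : V) (γ : V → Fin k) → V → Set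
  Moved x y γ s = ∃[ w ] (Mono x y w × Com x y s × s ~ w × φ s ≡ γ w)

  -- The hole moves from v to y and on to Mono x y; a vertex w there takes the colour γ w, and
  -- the vertices blocking this take the colour that y has left.
  augment : ∀ {x y} → Pair x y → (γ : V → Fin k) →
            (∀ {w} → Mono x y w → Free x y w (γ w)) →
            (∀ {s s′} → Moved x y γ s → Moved x y γ s′ → s ≁ s′) →
            (∀ {s t} → Moved x y γ s → Non x y t → φ t ≡ φ y → s ≁ t) → ⊥
  augment {x} {y} P γ γ-free stable away = recolouring Status status colour distinct
    where
    open Pair P
    moved? : ∀ s → Dec (Moved x y γ s)
    moved? s = any? λ w → mono? x y w ×-dec (com? x y s ×-dec ((s ~? w) ×-dec (φ s ≟ γ w)))
    data Status (u : V) : Set where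
      hole  : u ≡ v → Status u
      end   : u ≡ y → Status u
      mono  : Mono x y u → Status u
      moved : Moved x y γ u → Status u
      out   : u ≢ v → u ≢ y → ¬ Mono x y u → ¬ Moved x y γ u → Status u
    status : ∀ u → Status u
    status u with u ≟ v | u ≟ y | mono? x y u | moved? u
    ... | yes e | _     | _     | _     = hole e
    ... | no _  | yes e | _     | _     = end e
    ... | no _  | no _  | yes m | _     = mono m
    ... | no _  | no _  | no _  | yes m = moved m
    ... | no a  | no b  | no c  | no d  = out a b c d
    colour : ∀ {u} → Status u → Fin k
    colour     (hole _)      = φ y
    colour     (end _)       = φ x
    colour {u} (mono _)      = γ u
    colour     (moved _)     = φ y
    colour {u} (out _ _ _ _) = φ u
    γ≢φy : ∀ {w} → Mono x y w → γ w ≢ φ y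
    γ≢φy m eq = ¬opposite (γ-free m) (subst (Col y x) (≡.sym eq) (pvt-x (flip P)))
    hole-moved : ∀ {s} → Moved x y γ s → v ≁ s
    hole-moved (_ , _ , (_ , v≁s , _) , _) = v≁s
    hole-out : ∀ {h} → v ~ h → h ≢ y → φ y ≢ φ h
    hole-out v~h h≢y eq = h≢y (only uy v~h (≡.sym eq))
    end-out : ∀ {h} → y ~ h → h ≢ v → ¬ Mono x y h → φ x ≢ φ h
    end-out {h} y~h h≢v ¬m eq with adjacent? v h
    ... | inj₁ v~h = absurd (subst (y ~_) (only ux v~h (≡.sym eq)) y~h) (≁-sym x≁y)
    ... | inj₂ v≁h = ¬m ((v≁h , same (≢v ux) h≢v eq , y~h) , ≡.sym eq)
    -- A neighbour of `w` with its new colour is ruled out wherever it lies: near `v` by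
    -- `unique-pvt`, in A or B by `Free`, in `Non` by `non-pvt`, and in `Com` because it would have
    -- been moved.
    mono-out : ∀ {w h} → w ~ h → Mono x y w → h ≢ v → ¬ Moved x y γ h → γ w ≢ φ h
    mono-out {w} {h} w~h m@(R , _) h≢v ¬mv eq with adjacent? v h
    ... | inj₁ v~h = ¬opposite (γ-free m) (subst (Col y x) (≡.sym eq)
            (unique-pvt P (solo-unique (solo (γ-free m)) v~h (≡.sym eq)) R (~-sym w~h)))
    ... | inj₂ v≁h with place x y h≢v v≁h
    ...   | pvt Q  = ¬beside (γ-free m) Q w~h (≡.sym eq)
    ...   | pvtᵒ Q = ¬opposite (γ-free m) (h , Q , ≡.sym eq)
    ...   | com C  = ¬mv (w , m , C , ~-sym w~h , ≡.sym eq)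
    ...   | non N  = absurd (~-sym w~h) (non-pvt P N R)
    moved-out : ∀ {s h} → s ~ h → Moved x y γ s → h ≢ v → h ≢ y → φ y ≢ φ h
    moved-out {s} {h} s~h mv@(w , (R , _) , C , s~w , _) h≢v h≢y eq with adjacent? v h
    ... | inj₁ v~h = hole-out v~h h≢y eq
    ... | inj₂ v≁h with place x y h≢v v≁h
    ...   | pvt (_ , _ , y~h)      = absurd y~h (same (≢v uy) h≢v eq)
    ...   | pvtᵒ Q                 = absurd s~h (com-one-side P C Q R s~w)
    ...   | com (_ , _ , _ , y~h)  = absurd y~h (same (≢v uy) h≢v eq)
    ...   | non N                  = absurd s~h (away mv N (≡.sym eq))
    distinct : ∀ {u w} → u ~ w → (s : Status u) (t : Status w) → colour s ≢ colour t
    distinct u~w (hole refl) (hole refl) _ = ~-irrefl u~w refl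
    distinct u~w (hole _) (end _) = ≢-sym a≢b
    distinct u~w (hole refl) (mono ((v≁w , _) , _)) _ = absurd u~w v≁w
    distinct u~w (hole refl) (moved m) _ = absurd u~w (hole-moved m)
    distinct u~w (hole refl) (out _ e _ _) = hole-out u~w e
    distinct u~w (end _) (hole _) = a≢b
    distinct u~w (end refl) (end refl) _ = ~-irrefl u~w refl
    distinct u~w (end _) (mono m) = ≢-sym (≢old (γ-free m))
    distinct u~w (end _) (moved _) = a≢b
    distinct u~w (end refl) (out e _ m _) = end-out u~w e m
    distinct u~w (mono ((v≁u , _) , _)) (hole refl) _ = absurd (~-sym u~w) v≁u
    distinct u~w (mono m) (end _) = ≢old (γ-free m)
    distinct u~w (mono (R , φu)) (mono (R′ , φw)) _ =
      proper (pvt≢v P R) (pvt≢v P R′) u~w (trans φu (≡.sym φw))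
    distinct u~w (mono m) (moved _) = γ≢φy m
    distinct u~w (mono m) (out e _ _ d) = mono-out u~w m e d
    distinct u~w (moved m) (hole refl) _ = absurd (~-sym u~w) (hole-moved m)
    distinct u~w (moved _) (end _) = ≢-sym a≢b
    distinct u~w (moved _) (mono m) = ≢-sym (γ≢φy m)
    distinct u~w (moved m) (moved m′) _ = absurd u~w (stable m m′)
    distinct u~w (moved m) (out e e′ _ _) = moved-out u~w m e e′
    distinct u~w (out _ e _ _) (hole refl) = ≢-sym (hole-out (~-sym u~w) e)
    distinct u~w (out e _ m _) (end refl) = ≢-sym (end-out (~-sym u~w) e m)
    distinct u~w (out e _ _ d) (mono m) = ≢-sym (mono-out (~-sym u~w) m e d)
    distinct u~w (out e e′ _ _) (moved m) = ≢-sym (moved-out (~-sym u~w) m e e′)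
    distinct u~w (out e _ _ _) (out e′ _ _ _) = proper e e′ u~w

  Absent : V → V → Fin k → Set
  Absent x y c = Solo c × ¬ Col x y c × ¬ Col y x c

  -- Apply `augment` with constant `γ`. An absent colour is free throughout `Mono`, and moved
  -- vertices share the colour `c`, hence are independent; so only the last condition can fail.
  obstacle : ∀ {x y c} → Pair x y → Absent x y c →
             ∃[ w ] ∃[ s ] ∃[ t ] (Mono x y w × Com x y s × s ~ w × φ s ≡ c × Non x y t × s ~ t)
  obstacle {x} {y} {c} P (sc , ¬xy , ¬yx)
    with any? (λ w → any? λ s → any? λ t → mono? x y w ×-dec (com? x y s ×-dec ((s ~? w) ×-dec
           ((φ s ≟ c) ×-dec (((v ≁? t) ×-dec ((x ≁? t) ×-dec (y ≁? t))) ×-dec (s ~? t))))))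
  ... | yes found = found
  ... | no ¬found = ⊥-elim (augment P (λ _ → c)
      (λ m → mkFree sc ¬yx (λ { refl → ¬xy (pvt-x P) }) (λ R _ φr → ¬xy (_ , R , φr)))
      (λ { (_ , _ , (s≢v , _) , _ , φs) (_ , _ , (s′≢v , _) , _ , φs′) →
             same s≢v s′≢v (trans φs (≡.sym φs′)) })
      (λ { (w , m , C , s~w , φs) N _ →
             ¬~⇒≁ λ s~t → ¬found (w , _ , _ , m , C , s~w , φs , N , s~t) }))

  -- Obstacles to the moves through `y` and through `x` combine to an obstruction with `v` in role
  -- 4. The edge `t r` is forced, as `t s w p r` would otherwise be an induced path.
  ¬absent : ∀ {x y c} → Pair x y → ¬ Absent x y c
  ¬absent {x} {y} P ab@(sc , ¬xy , ¬yx)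
    with obstacle P ab | obstacle (flip P) (sc , ¬yx , ¬xy)
  ... | w , s , t , (W@(vw , xw , yw) , _) , C@(s≢v , vs , xs , ys) , s~w , φs , N@(vt , xt , yt) , s~t
      | p , r , _ , (Q@(vp , yp , xp) , _) , D@(r≢v , vr , yr , xr) , r~p , φr , _ =
    no₄ _ refl (knownCopy-sound
        {Γ = 4 ∼ 0 ∷ 4 ∼ 3 ∷ 0 ∼ 1 ∷ 0 ∼ 5 ∷ 0 ∼ 6 ∷ 3 ∼ 2 ∷ 3 ∼ 5 ∷ 3 ∼ 6 ∷ 1 ∼ 2 ∷ 5 ∼ 1 ∷
             6 ∼ 2 ∷ 7 ∼ 5 ∷ 6 ∼ 7 ∷ 0 ≀ 2 ∷ 0 ≀ 3 ∷ 0 ≀ 7 ∷ 3 ≀ 1 ∷ 6 ≀ 1 ∷ 7 ≀ 1 ∷ 4 ≀ 1 ∷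
             4 ≀ 2 ∷ 5 ≀ 2 ∷ 7 ≀ 2 ∷ 3 ≀ 7 ∷ 4 ≀ 5 ∷ 4 ≀ 6 ∷ 4 ≀ 7 ∷ 6 ≀ 5 ∷ []}
        obstruction (0 ∷ 1 ∷ 2 ∷ 3 ∷ 4 ∷ 5 ∷ 6 ∷ 7 ∷ [])
        (near ux ∷ near uy ∷ xp ∷ xr ∷ xs ∷ yw ∷ yr ∷ ys ∷ p~w ∷ r~p ∷ s~w ∷ t~r ∷ s~t ∷
         xw ∷ x≁y ∷ xt ∷ yp ∷ s≁p ∷ t≁p ∷ vp ∷ vw ∷ r≁w ∷ non-pvt P N W ∷ yt ∷
         vr ∷ vs ∷ vt ∷ s≁r ∷ [])
        _)
    where
    open Pair P
    open Refutation G free (nth v (x ∷ p ∷ w ∷ y ∷ v ∷ r ∷ s ∷ t ∷ []))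
    p~w : p ~ w
    p~w = pvt-complete P Q W
    s≁p : s ≁ p
    s≁p = com-one-side P C Q W s~w
    r≁w : r ≁ w
    r≁w = com-one-side (flip P) D W Q r~p
    t≁p : t ≁ p
    t≁p = non-pvt (flip P) (vt , yt , xt) Q
    s≁r : s ≁ r
    s≁r = same s≢v r≢v (trans φs (≡.sym φr))
    t~r : t ~ r
    t~r with adjacent? t r
    ... | inj₁ tr = tr
    ... | inj₂ tr = ⊥-elim (p5-free (~-sym s~t) s~w (~-sym p~w) (~-sym r~p)
                      (non-pvt P N W) t≁p tr s≁p s≁r (≁-sym r≁w))

  -- No colour is `Free` at `w`, put in the positive form that the greedy construction uses.
  Stuck : V → V → Set
  Stuck x y = ∃[ w ] (Mono x y w × ∀ c → Solo c → ¬ Col y x c → c ≢ φ x →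
                      ∃[ r ] (Pvt x y r × w ~ r × φ r ≡ c))

  -- Choosing new colours for the vertices of `Mono`

  module Choice {x y} (P : Pair x y) where
    open Pair P

    Link : V → V → Set
    Link s w = Mono x y w × s ~ w

    link? : ∀ s w → Dec (Link s w)
    link? s w = mono? x y w ×-dec (s ~? w)

    -- As `toℕ (φ s) < k`, `key` is the lexicographic order by number of links, then by colour.
    size key : V → ℕ
    size s = ∑ (λ w → indicator (link? s w))
    key s  = size s * k + toℕ (φ s)

    size-mono : ∀ {s s′} → (∀ {w} → Link s w → Link s′ w) → size s ≤ size s′
    size-mono {s} {s′} sub = ∑-mono-≤ λ w → indicator-mono (link? s w) (link? s′ w) sub

    size-< : ∀ {s s′ w} → (∀ {w} → Link s w → Link s′ w) → ¬ Link s w → Link s′ w → size s < size s′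
    size-< {s} {s′} {w} sub ¬l l′ =
      ∑-mono-< (λ u → indicator-mono (link? s u) (link? s′ u) sub) w
        (indicator-< (link? s w) (link? s′ w) ¬l l′)

    key-size : ∀ {s s′} → size s < size s′ → key s < key s′
    key-size {s} {s′} lt = begin-strict
      size s * k + toℕ (φ s)  <⟨ ℕ.+-monoʳ-< (size s * k) (toℕ<n (φ s)) ⟩
      size s * k + k          ≡⟨ ℕ.+-comm (size s * k) k ⟩
      suc (size s) * k        ≤⟨ ℕ.*-monoˡ-≤ k lt ⟩
      size s′ * k             ≤⟨ ℕ.m≤m+n _ _ ⟩
      size s′ * k + toℕ (φ s′) ∎
      where open ℕ.≤-Reasoning

    mono≁ : ∀ {w w′} → Mono x y w → Mono x y w′ → w ≁ w′
    mono≁ (R , φw) (R′ , φw′) = same (pvt≢v P R) (pvt≢v P R′) (trans φw (≡.sym φw′))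

    -- Otherwise `y` would be the hub of a gem over `u s w s′`.
    link-equal : ∀ {s s′ w} → Com x y s → Com x y s′ → s ≁ s′ → Link s w → Link s′ w →
                 ∀ {u} → Link s u → Link s′ u
    link-equal {s} {s′} (_ , _ , _ , ys) (_ , _ , _ , ys′) s≁s′ (m , sw) (_ , s′w) {u} (mu , su)
      with adjacent? s′ u
    ... | inj₁ s′u = mu , s′u
    ... | inj₂ s′u = ⊥-elim (gem-free (~-sym su) sw (~-sym s′w) (mono≁ mu m) (≁-sym s′u) s≁s′
                       (pvt-y mu) ys (pvt-y m) ys′)
      where
      pvt-y : ∀ {w} → Mono x y w → y ~ w
      pvt-y ((_ , _ , y~w) , _) = y~w

    -- Otherwise `y` would be the hub of a gem over `w s s′ w′`. So the link sets of adjacent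
    -- vertices are nested.
    link-nested : ∀ {s s′ w w′} → Com x y s → Com x y s′ → s ~ s′ →
                  Link s w → Link s′ w′ → s′ ~ w ⊎ s ~ w′
    link-nested {s} {s′} {w} {w′} (_ , _ , _ , ys) (_ , _ , _ , ys′) s~s′
      (m@((_ , _ , yw) , _) , sw) (m′@((_ , _ , yw′) , _) , s′w′)
      with adjacent? s′ w | adjacent? s w′
    ... | inj₁ p  | _       = inj₁ p
    ... | inj₂ _  | inj₁ p  = inj₂ p
    ... | inj₂ s′w | inj₂ sw′ = ⊥-elim (gem-free (~-sym sw) s~s′ s′w′ (≁-sym s′w) (mono≁ m m′) sw′
                                  yw ys ys′ yw′)

    free? : ∀ w c → Dec (Free x y w c)
    free? w c with solo? c ×-dec (¬? (col? y x c) ×-dec (¬? (c ≟ φ x) ×-dec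
                     ¬? (any? λ r → pvt? x y r ×-dec ((w ~? r) ×-dec (φ r ≟ c)))))
    ... | yes (a , b , d , e) = yes (mkFree a b d λ R w~r φr → e (_ , R , w~r , φr))
    ... | no ¬p = no λ f → ¬p (solo f , ¬opposite f , ≢old f ,
                               λ { (_ , R , w~r , φr) → ¬beside f R w~r φr })

    Candidate : V → V → Set
    Candidate w s = Com x y s × s ~ w × Free x y w (φ s)

    Best : V → Fin k → Set
    Best w c = Free x y w c × (∀ {s s′} → Com x y s → s ~ w → φ s ≡ c → Candidate w s′ → key s′ ≤ key s)

    -- Take the colour of a candidate with maximal key. Neighbours of `w` in `Com` sharing that
    -- colour have equal links by `link-equal`, hence equal keys. Without candidates nothing in
    -- `Com` blocks `c`.
    best : ∀ {w c} → Mono x y w → Free x y w c → ∃[ c ] Best w c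
    best {w} {c} m f
      with argmax {P = Candidate w} (λ s → com? x y s ×-dec ((s ~? w) ×-dec free? w (φ s))) key
    ... | inj₁ none = c , f , λ { C s~w refl _ → ⊥-elim (none _ (C , s~w , f)) }
    ... | inj₂ (s , (C , s~w , fs) , max) = φ s , fs , λ {_} {s′} C′ s′~w φs′ cand →
      ℕ.≤-trans (max s′ cand) (ℕ.≤-reflexive (key-equal C′ s′~w φs′))
      where
      key-equal : ∀ {s′} → Com x y s′ → s′ ~ w → φ s′ ≡ φ s → key s ≡ key s′
      key-equal {s′} C′ s′~w φs′ = ≡.cong₂ (λ a b → a * k + toℕ b)
        (ℕ.≤-antisym (size-mono (link-equal C C′ s≁s′ (m , s~w) (m , s′~w)))
                     (size-mono (link-equal C′ C (≁-sym s≁s′) (m , s′~w) (m , s~w)))) (≡.sym φs′)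
        where
        s≁s′ : s ≁ s′
        s≁s′ = same (proj₁ C) (proj₁ C′) (≡.sym φs′)

    -- If every vertex of `Mono` has a free colour, best choices make the moved vertices
    -- independent, and `augment` applies.
    stuck : (∀ c → Solo c → Col x y c ⊎ Col y x c) → Stuck x y
    stuck cover with any? (λ w → mono? x y w ×-dec ¬? (any? (free? w)))
    ... | yes (w , m , ¬free) = w , m , beside
      where
      beside : ∀ c → Solo c → ¬ Col y x c → c ≢ φ x → ∃[ r ] (Pvt x y r × w ~ r × φ r ≡ c)
      beside c sc ¬op ¬old with any? (λ r → pvt? x y r ×-dec ((w ~? r) ×-dec (φ r ≟ c)))
      ... | yes found = found
      ... | no ¬found = ⊥-elim (¬free (c , mkFree sc ¬op ¬old λ R w~r φr → ¬found (_ , R , w~r , φr)))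
    ... | no ¬stuck = ⊥-elim (augment P γ (λ m → proj₁ (γ-best m)) stable away)
      where
      choose : ∀ w → ∃[ c ] (Mono x y w → Best w c)
      choose w with mono? x y w
      -- Outside `Mono` the value is arbitrary; `φ v` just inhabits `Fin k`.
      ... | no ¬m = φ v , λ m → ⊥-elim (¬m m)
      ... | yes m with any? (free? w)
      ...   | yes (c , f) = proj₁ (best m f) , λ _ → proj₂ (best m f)
      ...   | no ¬f = ⊥-elim (¬stuck (w , m , ¬f))
      γ : V → Fin k
      γ w = proj₁ (choose w)
      γ-best : ∀ {w} → Mono x y w → Best w (γ w)
      γ-best {w} = proj₂ (choose w)
      transfer : ∀ {w₁ w₂ s} → Mono x y w₁ → Com x y s → φ s ≡ γ w₁ → Link s w₂ → Candidate w₂ s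
      transfer {w₁} {w₂} {s} m₁ C φs ((R , _) , s~w₂) =
        C , s~w₂ , mkFree (solo f) (¬opposite f) (≢old f) λ Q w₂~r φr → proper (proj₁ C) (pvt≢v P Q) (com-unmixed P C R Q w₂~r s~w₂) (≡.sym φr)
        where
        f : Free x y w₁ (φ s)
        f = subst (Free x y w₁) (≡.sym φs) (proj₁ (γ-best m₁))
      -- Having the larger link set, `s₁` is a candidate at `w₂`, so its key is at most that of
      -- `s₂`. Then the link sets agree, the roles can be exchanged, and equal keys give adjacent
      -- vertices the same colour.
      conflict : ∀ {s₁ s₂} → Moved x y γ s₁ → Moved x y γ s₂ → s₁ ~ s₂ →
                 (∀ {w} → Link s₂ w → Link s₁ w) → ⊥
      conflict {s₁} {s₂} (w₁ , m₁ , C₁ , l₁ , e₁) (w₂ , m₂ , C₂ , l₂ , e₂) s₁~s₂ sub =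
        proper (proj₁ C₁) (proj₁ C₂) s₁~s₂ (toℕ-injective (ℕ.+-cancelˡ-≡ (size s₁ * k) _ _
          (trans keys (cong (λ a → a * k + toℕ (φ s₂)) (≡.sym sizes)))))
        where
        key₁≤key₂ : key s₁ ≤ key s₂
        key₁≤key₂ = proj₂ (γ-best m₂) C₂ l₂ e₂ (transfer m₁ C₁ e₁ (sub (m₂ , l₂)))
        sub⁻ : ∀ {w} → Link s₁ w → Link s₂ w
        sub⁻ {w} l with link? s₂ w
        ... | yes l′ = l′
        ... | no ¬l′ = ⊥-elim (ℕ.<⇒≱ (key-size (size-< sub ¬l′ l)) key₁≤key₂)
        sizes : size s₁ ≡ size s₂
        sizes = ℕ.≤-antisym (size-mono sub⁻) (size-mono sub)
        keys : key s₁ ≡ key s₂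
        keys = ℕ.≤-antisym key₁≤key₂
          (proj₂ (γ-best m₁) C₁ l₁ e₁ (transfer m₂ C₂ e₂ (sub⁻ (m₁ , l₁))))
      stable : ∀ {s₁ s₂} → Moved x y γ s₁ → Moved x y γ s₂ → s₁ ≁ s₂
      stable {s₁} {s₂} M₁@(_ , _ , C₁ , _) M₂@(_ , _ , C₂ , _) = ¬~⇒≁ clash
        where
        clash : s₁ ~ s₂ → ⊥
        clash s₁~s₂ with any? (λ w → link? s₁ w ×-dec ¬? (link? s₂ w))
        ... | no none = conflict M₂ M₁ (~-sym s₁~s₂) λ {w} l →
          decidable-stable (link? s₂ w) λ ¬l → none (w , l , ¬l)
        ... | yes (w , l , ¬l) = conflict M₁ M₂ s₁~s₂ λ {w′} l′ → proj₁ l′ ,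
          [ (λ s₂~w → ⊥-elim (¬l (proj₁ l , s₂~w))) , (λ p → p) ]′ (link-nested C₁ C₂ s₁~s₂ l l′)
      -- By `cover` some `r` in A already has the colour of `s`; an edge `s t` would make
      -- `t s x p r` an induced path.
      away : ∀ {s t} → Moved x y γ s → Non x y t → φ t ≡ φ y → s ≁ t
      away {s} {t} (w , m@(W , _) , C@(s≢v , _ , xs , _) , s~w , φs) N@(vt , xt , yt) _
        with cover (γ w) (solo (proj₁ (γ-best m)))
      ... | inj₂ op = ⊥-elim (¬opposite (proj₁ (γ-best m)) op)
      ... | inj₁ (r , R@(_ , xr , _) , φr) with pvt-x (flip P)
      ...   | p , Q@(_ , _ , xp) , _ = ¬~⇒≁ λ s~t →
            p5-free (~-sym s~t) (~-sym xs) xp (pvt-complete P Q R)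
              (≁-sym xt) (non-pvt (flip P) (vt , yt , xt) Q) (non-pvt P N R)
              (com-one-side P C Q W s~w) (same s≢v (pvt≢v P R) (trans φs (≡.sym φr))) xr

  -- Building a clique in A by decreasing colour

  module Greedy {x y} (P : Pair x y) (st : Stuck x y) where
    open Pair P

    S : Fin k → Set
    S c = Solo c × ¬ Col y x c

    s? : ∀ c → Dec (S c)
    s? c = solo? c ×-dec ¬? (col? y x c)

    w : V
    w = proj₁ st

    a : Fin k
    a = φ x

    W : Pvt x y w
    W = proj₁ (proj₁ (proj₂ st))

    w-beside : ∀ {c} → S c → c ≢ a → ∃[ r ] (Pvt x y r × w ~ r × φ r ≡ c)
    w-beside (sc , ¬op) ≢a = proj₂ (proj₂ st) _ sc ¬op ≢a

    -- Minimality supplies a neighbour `h` of `r` coloured `c`. It must lie in A: in `Com` it would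
    -- see, through `r` and `w`, another vertex of colour `c`, and the other positions conflict with
    -- `S c` or `non-pvt`.
    r-beside : ∀ {r c} → Pvt x y r → w ~ r → S c → c ≢ a → toℕ c < toℕ (φ r) →
               ∃[ r′ ] (Pvt x y r′ × r ~ r′ × φ r′ ≡ c)
    r-beside {r} R w~r S@(sc , ¬op) ≢a lt with minimal (pvt≢v P R) lt
    ... | h , h≢v , r~h , refl with adjacent? v h
    ...   | inj₁ v~h = ⊥-elim (¬op (unique-pvt P (solo-unique sc v~h refl) R (~-sym r~h)))
    ...   | inj₂ v≁h with place x y h≢v v≁h
    ...     | pvt Q  = h , Q , r~h , refl
    ...     | pvtᵒ Q = ⊥-elim (¬op (h , Q , refl))
    ...     | non N  = absurd (~-sym r~h) (non-pvt P N R)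
    ...     | com C with w-beside S ≢a
    ...       | r″ , R″ , w~r″ , φr″ = ⊥-elim (proper h≢v (pvt≢v P R″)
                  (com-unmixed P C W R″ w~r″ (com-unmixed P C R W (~-sym w~r) (~-sym r~h))) (≡.sym φr″))

    Active : ℕ → Fin k → Set
    Active j c = c ≡ a ⊎ (S c × j ≤ toℕ c)

    active? : ∀ j c → Dec (Active j c)
    active? j c = (c ≟ a) ⊎-dec (s? c ×-dec (j ℕ.≤? toℕ c))

    record Clique (j : ℕ) : Set where
      field
        g     : Fin k → V
        base  : g a ≡ w
        inPvt : ∀ {c} → Active j c → Pvt x y (g c)
        col   : ∀ {c} → Active j c → φ (g c) ≡ c
        adjg  : ∀ {c d} → Active j c → Active j d → c ≢ d → g c ~ g d

    open Clique

    -- P₄-freeness lets one vertex of colour c serve all members of the clique.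
    joint : ∀ {j c} (Q : Clique (suc j)) → toℕ c ≡ j → S c → c ≢ a →
            ∀ ds → All (Active (suc j)) ds →
            ∃[ s ] (Pvt x y s × φ s ≡ c × All (λ d → s ~ g Q d) ds)
    joint Q c≡j Sc ≢a [] [] with w-beside Sc ≢a
    ... | r , R , _ , φr = r , R , φr , []
    joint {j} {c} Q c≡j Sc ≢a (d ∷ ds) (act ∷ acts) with joint Q c≡j Sc ≢a ds acts
    ... | s , Ps , φs , s~ with adjacent? s (g Q d)
    ...   | inj₁ s~d = s , Ps , φs , s~d ∷ s~
    ...   | inj₂ s≁d with beside act
      where
      beside : ∀ {d} → Active (suc j) d → ∃[ r ] (Pvt x y r × g Q d ~ r × φ r ≡ c)
      beside (inj₁ refl) = subst (λ u → ∃[ r ] (Pvt x y r × u ~ r × φ r ≡ c)) (≡.sym (base Q))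
        (w-beside Sc ≢a)
      beside {d} act@(inj₂ (_ , j<d)) with d ≟ a
      ... | yes refl = beside (inj₁ refl)
      -- An active colour other than `a` exceeds `j`, the value of `c`, and its vertex is adjacent
      -- to `w`.
      ... | no d≢a = r-beside (inPvt Q act)
        (subst (_~ g Q d) (base Q) (adjg Q (inj₁ refl) act (≢-sym d≢a))) Sc ≢a
        (≡.subst₂ _<_ (≡.sym c≡j) (cong toℕ (≡.sym (col Q act))) j<d)
    ...     | s′ , Ps′ , d~s′ , φs′ = s′ , Ps′ , φs′ , ~-sym d~s′ ∷ rest acts s~
      where
      rest : ∀ {es} → All (Active (suc j)) es → All (λ e → s ~ g Q e) es → All (λ e → s′ ~ g Q e) es
      rest [] [] = []
      rest {e ∷ _} (act′ ∷ acts) (s~e ∷ s~es) = s′~e ∷ rest acts s~es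
        where
        s′~e : s′ ~ g Q e
        s′~e with adjacent? s′ (g Q e) | e ≟ d
        ... | inj₁ p | _        = p
        ... | inj₂ _ | yes refl = absurd s~e s≁d
        -- Otherwise `s`, `g Q e`, `g Q d`, `s′` would be an induced P₄ in A.
        ... | inj₂ q | no e≢d   = ⊥-elim (pvt-P4-free P Ps (inPvt Q act′) (inPvt Q act) Ps′
                s~e (adjg Q act′ act e≢d) d~s′ s≁d
                (same (pvt≢v P Ps) (pvt≢v P Ps′) (trans φs (≡.sym φs′))) (≁-sym q))

    module _ {j} (j<k : j < k) (Q : Clique (suc j)) where

      next : Fin k
      next = fromℕ< j<k

      later : ∀ {d} → d ≢ next → Active j d → Active (suc j) d
      later _      (inj₁ e)          = inj₁ e
      later d≢next (inj₂ (Sd , j≤d)) = inj₂ (Sd , ℕ.≤∧≢⇒< j≤d λ j≡d →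
        d≢next (toℕ-injective (trans (≡.sym j≡d) (≡.sym (toℕ-fromℕ< j<k)))))

      same-active : ¬ S next ⊎ next ≡ a → ∀ {d} → Active j d → Active (suc j) d
      same-active skip {d} act with d ≟ next
      ... | no ≢next = later ≢next act
      same-active _          (inj₁ e)        | yes refl = inj₁ e
      same-active (inj₁ ¬Sd) (inj₂ (Sd , _)) | yes refl = ⊥-elim (¬Sd Sd)
      same-active (inj₂ e)   (inj₂ _)        | yes refl = inj₁ e

      keep : ¬ S next ⊎ next ≡ a → Clique j
      keep skip = record
        { g = g Q ; base = base Q
        ; inPvt = λ act → inPvt Q (same-active skip act)
        ; col = λ act → col Q (same-active skip act)
        ; adjg = λ act act′ → adjg Q (same-active skip act) (same-active skip act′) }

      grow : S next → next ≢ a → Clique j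
      grow Sn n≢a with joint Q (toℕ-fromℕ< j<k) Sn n≢a (filter (active? (suc j)) (allFin k))
                         (All.all-filter (active? (suc j)) (allFin k))
      ... | s , Ps , φs , s~ = record
        { g = g′ ; base = base′ ; inPvt = inPvt′ ; col = col′ ; adjg = adjg′ }
        where
        s~g : ∀ {d} → Active (suc j) d → s ~ g Q d
        s~g act = All.lookup s~ (∈-filter⁺ (active? (suc j)) (∈-allFin _) act)
        g′ : Fin k → V
        g′ d with d ≟ next
        ... | yes _ = s
        ... | no _  = g Q d
        base′ : g′ a ≡ w
        base′ with a ≟ next
        ... | yes e = ⊥-elim (n≢a (≡.sym e))
        ... | no _  = base Q
        inPvt′ : ∀ {d} → Active j d → Pvt x y (g′ d)
        inPvt′ {d} act with d ≟ next
        ... | yes _ = Ps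
        ... | no ne = inPvt Q (later ne act)
        col′ : ∀ {d} → Active j d → φ (g′ d) ≡ d
        col′ {d} act with d ≟ next
        ... | yes refl = φs
        ... | no ne    = col Q (later ne act)
        adjg′ : ∀ {d e} → Active j d → Active j e → d ≢ e → g′ d ~ g′ e
        adjg′ {d} {e} actd acte d≢e with d ≟ next | e ≟ next
        ... | yes refl | yes refl = ⊥-elim (d≢e refl)
        ... | yes _    | no ne    = s~g (later ne acte)
        ... | no nd    | yes _    = ~-sym (s~g (later nd actd))
        ... | no nd    | no ne    = adjg Q (later nd actd) (later ne acte) d≢e

      extend : Clique j
      extend with s? next | next ≟ a
      ... | no ¬Sn | _     = keep (inj₁ ¬Sn)
      ... | yes _  | yes e = keep (inj₂ e)
      ... | yes Sn | no ≢a = grow Sn ≢a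

    start : Clique k
    start = record
      { g = λ _ → w ; base = refl
      ; inPvt = λ _ → W
      ; col = λ act → trans (proj₂ (proj₁ (proj₂ st))) (≡.sym (only-a act))
      ; adjg = λ act act′ c≢d → ⊥-elim (c≢d (trans (only-a act) (≡.sym (only-a act′)))) }
      where
      only-a : ∀ {c} → Active k c → c ≡ a
      only-a (inj₁ e) = e
      only-a {c} (inj₂ (_ , k≤c)) = ⊥-elim (ℕ.<⇒≱ (toℕ<n c) k≤c)

    descend : ∀ i {j} → i + j ≡ k → Clique j
    descend zero    refl = start
    descend (suc i) {j} eq =
      extend (subst (j <_) eq (s≤s (ℕ.m≤n+m j i))) (descend i (trans (ℕ.+-suc i j) eq))

    clique : Clique 0
    clique = descend k (ℕ.+-identityʳ k)

  -- Both sides are stuck, and each solo colour is active in the clique on its own side. Since A and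
  -- B are complete to each other, the parts form a clique of size `ω + 1`.
  ¬pair : ∀ {x y} → ¬ Pair x y
  ¬pair {x} {y} P = cliques f adjf
    where
    cover : ∀ c → Solo c → Col x y c ⊎ Col y x c
    cover c sc with col? x y c | col? y x c
    ... | yes p | _     = inj₁ p
    ... | no _  | yes q = inj₂ q
    ... | no ¬p | no ¬q = ⊥-elim (¬absent P (sc , ¬p , ¬q))
    module L = Greedy P (Choice.stuck P cover)
    module R = Greedy (flip P) (Choice.stuck (flip P) λ c sc → [ inj₂ , inj₁ ]′ (cover c sc))
    module A = L.Clique L.clique
    module B = R.Clique R.clique
    f : Fin (suc ω) → V
    f i with col? y x (φ (u i))
    ... | yes _ = B.g (φ (u i))
    ... | no _  = A.g (φ (u i))
    right : ∀ i → Col y x (φ (u i)) → R.Active 0 (φ (u i))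
    right i q = inj₂ (((i , refl) , λ p → col-disjoint P p q) , z≤n)
    left : ∀ i → ¬ Col y x (φ (u i)) → L.Active 0 (φ (u i))
    left i ¬q = inj₂ (((i , refl) , ¬q) , z≤n)
    adjf : ∀ i j → i ≢ j → f i ~ f j
    adjf i j i≢j with col? y x (φ (u i)) | col? y x (φ (u j))
    ... | yes p | yes q = B.adjg (right i p) (right j q) (i≢j ∘ φu-injective)
    ... | yes p | no q  = pvt-complete P (B.inPvt (right i p)) (A.inPvt (left j q))
    ... | no p  | yes q = ~-sym (pvt-complete P (B.inPvt (right j q)) (A.inPvt (left i p)))
    ... | no p  | no q  = A.adjg (left i p) (left j q) (i≢j ∘ φu-injective)

  contradiction : ⊥
  contradiction = cliques u λ i j i≢j → adjacent i≢j
    where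
    adjacent : ∀ {i j} → i ≢ j → u i ~ u j
    adjacent {i} {j} i≢j with adjacent? (u i) (u j)
    ... | inj₁ p = p
    ... | inj₂ q = ⊥-elim (¬pair (pair (unique i) (unique j) (i≢j ∘ φu-injective ∘ cong φ) q))

-- Hypotheses for induction on the number of vertices

-- The maximum degree enters only through the fixed `k`, so that all conditions survive vertex
-- deletion with `ω` and `k` unchanged.
record Sparse {n} (G : Graph n) (ω k : ℕ) : Set where
  field
    free    : P5GemFree G
    cliques : ∀ (f : Fin (suc ω) → Fin n) → ¬ (∀ i j → i ≢ j → Adj G (f i) (f j))
    degrees : ∀ u {m} (f : Fin m → Fin n) → Injective _≡_ _≡_ f → (∀ i → Adj G u (f i)) → m + ω < k + k

open Sparse

_─_ : ∀ {n} → Graph (suc n) → Fin (suc n) → Graph n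
G ─ v = record
  { adj   = λ i j → adj G (punchIn v i) (punchIn v j)
  ; sym   = λ i j → sym G (punchIn v i) (punchIn v j)
  ; irref = λ i → irref G (punchIn v i) }

sparse-─ : ∀ {n} {G : Graph (suc n)} {ω k} v → Sparse G ω k → Sparse (G ─ v) ω k
sparse-─ {G = G} v S = record
  { free    = (λ (f , inj , copy) →
                  proj₁ (free S) (punchIn v ∘ f , inj ∘ punchIn-injective v _ _ , copy))
            , (λ (f , inj , copy) →
                  proj₂ (free S) (punchIn v ∘ f , inj ∘ punchIn-injective v _ _ , copy))
  ; cliques = λ f → cliques S (punchIn v ∘ f)
  ; degrees = λ u f inj → degrees S (punchIn v u) (punchIn v ∘ f) (inj ∘ punchIn-injective v _ _) }

-- Exhaustive search over encoded functions; it makes the proof by contradiction constructive.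
colourable? : ∀ {n} (G : Graph n) k → Dec (Colourable G k)
colourable? {n} G k = map′
  (λ { (i , p) → finToFun i , p })
  (λ { (c , p) → funToFin c , λ u w u~w eq → p u w u~w
         (trans (≡.sym (finToFun-funToFin c u)) (trans eq (finToFun-funToFin c w))) })
  (any? λ i → all? λ u → all? λ w → (adj G u w Bool.≟ true) →-dec ¬? (finToFun i u ≟ finToFun i w))

-- Counting the colours that occur once

record Split {k} (P : Fin k → Set) : Set where
  field
    {m m′}  : ℕ
    total   : m + m′ ≡ k
    in₊     : Fin m → Fin k
    in₊-inj : ∀ {i j} → in₊ i ≡ in₊ j → i ≡ j
    in₊-P   : ∀ i → P (in₊ i)
    in₋     : Fin m′ → Fin k
    in₋-inj : ∀ {i j} → in₋ i ≡ in₋ j → i ≡ j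
    in₋-P   : ∀ i → ¬ P (in₋ i)

private
  cons : ∀ {k m} → (Fin m → Fin k) → Fin (suc m) → Fin (suc k)
  cons f zero    = zero
  cons f (suc i) = suc (f i)

  cons-inj : ∀ {k m} (f : Fin m → Fin k) → (∀ {i j} → f i ≡ f j → i ≡ j) →
             ∀ {i j} → cons f i ≡ cons f j → i ≡ j
  cons-inj f inj {zero}  {zero}  eq   = refl
  cons-inj f inj {suc i} {suc j} eq = cong suc (inj (suc-injective eq))

split-by : ∀ {k} {P : Fin k → Set} → (∀ c → Dec (P c)) → Split P
split-by {zero} P? = record
  { m = 0 ; m′ = 0 ; total = refl ; in₊ = λ () ; in₊-inj = λ { {()} } ; in₊-P = λ ()
  ; in₋ = λ () ; in₋-inj = λ { {()} } ; in₋-P = λ () }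
split-by {suc k} P? with split-by (P? ∘ suc) | P? zero
... | s | yes p = record
  { total = cong suc total ; in₊ = cons in₊ ; in₊-inj = cons-inj in₊ in₊-inj
  ; in₊-P = λ { zero → p ; (suc i) → in₊-P i }
  ; in₋ = suc ∘ in₋ ; in₋-inj = in₋-inj ∘ suc-injective ; in₋-P = in₋-P }
  where open Split s
... | s | no ¬p = record
  { total = trans (ℕ.+-suc m m′) (cong suc total)
  ; in₊ = suc ∘ in₊ ; in₊-inj = in₊-inj ∘ suc-injective ; in₊-P = in₊-P
  ; in₋ = cons in₋ ; in₋-inj = cons-inj in₋ in₋-inj
  ; in₋-P = λ { zero → ¬p ; (suc i) → in₋-P i } }
  where open Split s

module _ {n k ω : ℕ} (N : Fin n → Set) (N? : ∀ u → Dec (N u)) (φ : Fin n → Fin k)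
  (seen : ∀ c → ∃[ u ] (N u × φ u ≡ c))
  (few : ∀ {m} (f : Fin m → Fin n) → Injective _≡_ _≡_ f → (∀ i → N (f i)) → m + ω < k + k) where

  private
    Second : Fin k → Set
    Second c = ∃[ w ] (N w × φ w ≡ c × w ≢ proj₁ (seen c))

    second? : ∀ c → Dec (Second c)
    second? c = any? λ w → N? w ×-dec ((φ w ≟ c) ×-dec ¬? (w ≟ proj₁ (seen c)))

    φ-seen : ∀ c → φ (proj₁ (seen c)) ≡ c
    φ-seen c = proj₂ (proj₂ (seen c))

    module _ (s : Split (¬_ ∘ Second)) where
      open Split s

      second : ∀ i → Second (in₋ i)
      second i = decidable-stable (second? (in₋ i)) (in₋-P i)

      neighbour : Fin k ⊎ Fin m′ → Fin n
      neighbour (inj₁ c) = proj₁ (seen c)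
      neighbour (inj₂ i) = proj₁ (second i)

      neighbour-N : ∀ t → N (neighbour t)
      neighbour-N (inj₁ c) = proj₁ (proj₂ (seen c))
      neighbour-N (inj₂ i) = proj₁ (proj₂ (second i))

      φ-second : ∀ i → φ (proj₁ (second i)) ≡ in₋ i
      φ-second i = proj₁ (proj₂ (proj₂ (second i)))

      seen≢second : ∀ c i → proj₁ (seen c) ≢ proj₁ (second i)
      seen≢second c i eq with trans (≡.sym (φ-seen c)) (trans (cong φ eq) (φ-second i))
      ... | refl = proj₂ (proj₂ (proj₂ (second i))) (≡.sym eq)

      neighbour-injective : ∀ t t′ → neighbour t ≡ neighbour t′ → t ≡ t′
      neighbour-injective (inj₁ c) (inj₁ d) eq =
        cong inj₁ (trans (≡.sym (φ-seen c)) (trans (cong φ eq) (φ-seen d)))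
      neighbour-injective (inj₁ c) (inj₂ j) eq = ⊥-elim (seen≢second c j eq)
      neighbour-injective (inj₂ i) (inj₁ d) eq = ⊥-elim (seen≢second d i (≡.sym eq))
      neighbour-injective (inj₂ i) (inj₂ j) eq =
        cong inj₂ (in₋-inj (trans (≡.sym (φ-second i)) (trans (cong φ eq) (φ-second j))))

      splitAt-injective : ∀ {i j} → splitAt k {m′} i ≡ splitAt k j → i ≡ j
      splitAt-injective {i} {j} eq =
        trans (≡.sym (join-splitAt k m′ i)) (trans (cong (join k m′) eq) (join-splitAt k m′ j))

      -- One neighbour per colour and a second one for each of the `m′` repeated colours are
      -- `k + m′` distinct vertices, so `k + m′ + ω < k + k = k + m + m′`.
      ω<m : ω < m
      ω<m = ℕ.+-cancelʳ-< m′ ω m (ℕ.+-cancelˡ-< k (ω + m′) (m + m′) (begin-strict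
        k + (ω + m′)  ≡⟨ cong (k +_) (ℕ.+-comm ω m′) ⟩
        k + (m′ + ω)  ≡⟨ ℕ.+-assoc k m′ ω ⟨
        k + m′ + ω    <⟨ few (neighbour ∘ splitAt k) (splitAt-injective ∘ neighbour-injective _ _)
                           (neighbour-N ∘ splitAt k) ⟩
        k + k         ≡⟨ cong (k +_) total ⟨
        k + (m + m′)  ∎))
        where open ℕ.≤-Reasoning

  unique-colours : ∃[ u ] ((∀ {i j : Fin (suc ω)} → φ (u i) ≡ φ (u j) → i ≡ j) ×
                           (∀ i → N (u i)) × (∀ i {w} → N w → φ w ≡ φ (u i) → w ≡ u i))
  unique-colours = u , u-injective , (λ i → proj₁ (proj₂ (seen (κ i)))) , only
    where
    s = split-by (¬? ∘ second?)
    open Split s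
    κ : Fin (suc ω) → Fin k
    κ i = in₊ (inject≤ i (ω<m s))
    u : Fin (suc ω) → Fin n
    u i = proj₁ (seen (κ i))
    u-injective : ∀ {i j} → φ (u i) ≡ φ (u j) → i ≡ j
    u-injective {i} {j} eq = inject≤-injective (ω<m s) (ω<m s) _ _
      (in₊-inj (trans (≡.sym (φ-seen (κ i))) (trans eq (φ-seen (κ j)))))
    only : ∀ i {w} → N w → φ w ≡ φ (u i) → w ≡ u i
    only i {w} Nw φw with w ≟ u i
    ... | yes e = e
    ... | no ne = ⊥-elim (in₊-P (inject≤ i (ω<m s)) (w , Nw , trans φw (φ-seen (κ i)) , ne))

-- Minimal colourings and the induction

module Minimise {n : ℕ} (k : ℕ) (G : Graph n) (v : Fin n) where

  ProperOff : (Fin n → Fin k) → Set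
  ProperOff φ = ∀ {u w} → u ≢ v → w ≢ v → Adj G u w → φ u ≢ φ w

  Minimal : (Fin n → Fin k) → Set
  Minimal φ = ∀ {w c} → w ≢ v → toℕ c < toℕ (φ w) → ∃[ h ] (h ≢ v × Adj G w h × φ h ≡ c)

  open Adjacency G

  -- Any vertex other than `v` that can be lowered to a smaller colour is lowered; the sum of the
  -- colours decreases.
  minimise : ∀ φ → Acc _<_ (∑ (toℕ ∘ φ)) → ProperOff φ → ∃[ ψ ] (ProperOff ψ × Minimal ψ)
  minimise φ (acc rec) proper with any? (λ w → any? λ c → ¬? (w ≟ v) ×-dec ((toℕ c ℕ.<? toℕ (φ w)) ×-dec
      ¬? (any? λ h → ¬? (h ≟ v) ×-dec ((w ~? h) ×-dec (φ h ≟ c)))))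
  ... | no ¬low = φ , proper , minimal
    where
    minimal : Minimal φ
    minimal {w} {c} w≢v lt with any? (λ h → ¬? (h ≟ v) ×-dec ((w ~? h) ×-dec (φ h ≟ c)))
    ... | yes found = found
    ... | no ¬found = ⊥-elim (¬low (w , c , w≢v , lt , ¬found))
  ... | yes (w , c , w≢v , lt , ¬seen) = minimise ψ (rec (∑-mono-< below w (at-w))) proper′
    where
    ψ : Fin n → Fin k
    ψ u with u ≟ w
    ... | yes _ = c
    ... | no _  = φ u
    below : ∀ u → toℕ (ψ u) ≤ toℕ (φ u)
    below u with u ≟ w
    ... | yes refl = ℕ.<⇒≤ lt
    ... | no _     = ℕ.≤-refl
    at-w : toℕ (ψ w) < toℕ (φ w)
    at-w with w ≟ w
    ... | yes _ = lt
    ... | no ne = ⊥-elim (ne refl)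
    proper′ : ProperOff ψ
    proper′ {a} {b} a≢v b≢v a~b with a ≟ w | b ≟ w
    ... | yes refl | yes refl = λ _ → ~-irrefl a~b refl
    ... | yes refl | no _     = λ eq → ¬seen (b , b≢v , a~b , ≡.sym eq)
    ... | no _     | yes refl = λ eq → ¬seen (a , a≢v , ~-sym a~b , eq)
    ... | no _     | no _     = proper a≢v b≢v a~b

module _ {n k ω} {G : Graph (suc n)} (S : Sparse G ω k) (smaller : ∀ v → Colourable (G ─ v) k)
         (uncolourable : ¬ Colourable G k) where

  open Adjacency G

  colour₀ : Fin k
  -- The degree condition for an empty family reads `ω < k + k`, so a colour exists. It serves as
  -- the junk value at `v`.
  colour₀ = least (degrees S zero {0} (λ ()) (λ { {()} }) (λ ()))
    where
    least : ∀ {ω k} → ω < k + k → Fin k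
    least {k = suc _} _ = zero

  partial : ∀ v → ∃[ φ ] Minimise.ProperOff k G v φ
  partial v = φ , proper
    where
    c = proj₁ (smaller v)
    φ : Fin (suc n) → Fin k
    φ u with v ≟ u
    ... | yes _ = colour₀
    ... | no ne = c (punchOut ne)
    proper : Minimise.ProperOff k G v φ
    proper {u} {w} u≢v w≢v u~w with v ≟ u | v ≟ w
    ... | yes e | _     = ⊥-elim (u≢v (≡.sym e))
    ... | no _  | yes e = ⊥-elim (w≢v (≡.sym e))
    ... | no p  | no q  = proj₂ (smaller v) (punchOut p) (punchOut q)
      (trans (cong₂ (adj G) (punchIn-punchOut p) (punchIn-punchOut q)) u~w)

  extension : ∀ v → (∀ f → f (# 1) ≡ v → ¬ Copy G obstruction f) →
              (∀ f → f (# 4) ≡ v → ¬ Copy G obstruction f) → ⊥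
  extension v no₁ no₄ = minimised (minimise _ (<-wellFounded _) (proj₂ (partial v)))
    where
    open Minimise k G v
    module _ (φ : Fin (suc n) → Fin k) (proper : ProperOff φ) (minimal : Minimal φ) where
      enumerated : ∃[ u ] ((∀ {i j : Fin (suc ω)} → φ (u i) ≡ φ (u j) → i ≡ j) ×
                     (∀ i → v ~ u i) × (∀ i {w} → v ~ w → φ w ≡ φ (u i) → w ≡ u i)) → ⊥
      enumerated (u , φu-injective , near , only) = Extension.contradiction G (free S) uncolourable
        (cliques S) v no₁ no₄ φ proper minimal u φu-injective
        (λ i → record { near = near i ; only = only i })
    minimised : ∃[ φ ] (ProperOff φ × Minimal φ) → ⊥
    minimised (φ , proper , minimal) = enumerated φ proper minimal
      (unique-colours (v ~_) (v ~?_) φ (Hole.seen G (free S) uncolourable v no₁ φ proper) (degrees S v))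

  -- If v is in role 1 or 4 of an obstruction, the vertex in role 0 of it serves instead.
  impossible : ⊥
  impossible = extension zero (λ f _ → redirect f) (λ f _ → redirect f)
    where
    redirect : ∀ f → ¬ Copy G obstruction f
    redirect f cf = extension (f (# 0))
      (λ g eq cg → Roles.role₀-not-role₁ G (free S) cf cg eq)
      (λ g eq cg → Roles.role₀-not-role₄ G (free S) cf cg eq)

sparse-colourable : ∀ {n ω k} (G : Graph n) → Sparse G ω k → Colourable G k
sparse-colourable {zero}          G S = (λ ()) , λ ()
sparse-colourable {suc n} {k = k} G S with colourable? G k
... | yes c = c
... | no ¬c = ⊥-elim (impossible S (λ v → sparse-colourable (G ─ v) (sparse-─ v S)) ¬c)

-- Degrees, clique number and the bound

bit : Bool → ℕ
bit b = if b then 1 else 0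

top : ∀ x {m} → x ≡ true → Fin (bit x + m)
top true _ = zero

up : ∀ x {m} → Fin m → Fin (bit x + m)
up true  i = suc i
up false i = i

up-injective : ∀ x {m} {i j : Fin m} → up x i ≡ up x j → i ≡ j
up-injective true  = suc-injective
up-injective false = id

top≢up : ∀ x {m} x≡true {i : Fin m} → top x x≡true ≢ up x i
top≢up true _ ()

rank : ∀ {n} (b : Fin n → Bool) i → b i ≡ true → Fin (∑ (bit ∘ b))
rank b zero    bi = top (b zero) bi
rank b (suc i) bi = up (b zero) (rank (b ∘ suc) i bi)

rank-injective : ∀ {n} (b : Fin n → Bool) i j bi bj → rank b i bi ≡ rank b j bj → i ≡ j
rank-injective b zero    zero    bi bj eq = refl
rank-injective b zero    (suc j) bi bj eq = ⊥-elim (top≢up (b zero) bi eq)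
rank-injective b (suc i) zero    bi bj eq = ⊥-elim (top≢up (b zero) bj (≡.sym eq))
rank-injective b (suc i) (suc j) bi bj eq =
  cong suc (rank-injective (b ∘ suc) i j bi bj (up-injective (b zero) eq))

-- Composing `f` with the rank among the true entries of `b` embeds `Fin m` into a type of that
-- size.
injection-≤ : ∀ {n m} (b : Fin n → Bool) (f : Fin m → Fin n) → Injective _≡_ _≡_ f →
              (∀ i → b (f i) ≡ true) → m ≤ ∑ (bit ∘ b)
injection-≤ b f inj bf = injective⇒≤ {f = λ i → rank b (f i) (bf i)}
  λ {i} {j} eq → inj (rank-injective b (f i) (f j) (bf i) (bf j) eq)

degree-∑ : ∀ {n} (G : Graph n) u → degree G u ≡ ∑ (bit ∘ adj G u)
degree-∑ G u = cong sum (map-tabulate id (bit ∘ adj G u))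

∣tabulate∣ : ∀ {n} (b : Fin n → Bool) → ∣ Vec.tabulate b ∣ ≡ ∑ (bit ∘ b)
∣tabulate∣ {zero}  b = refl
∣tabulate∣ {suc n} b with b zero
... | true  = cong suc (∣tabulate∣ (b ∘ suc))
... | false = ∣tabulate∣ (b ∘ suc)

maximum : List ℕ → ℕ
maximum = foldr _⊔_ 0

≤-maximum : ∀ {n} (f : Fin n → ℕ) i → f i ≤ maximum (tabulate f)
≤-maximum f zero    = ℕ.m≤m⊔n _ _
≤-maximum f (suc i) = ℕ.≤-trans (≤-maximum (f ∘ suc) i) (ℕ.m≤n⊔m (f zero) _)

maximum-≤ : ∀ {n b} (f : Fin n → ℕ) → (∀ i → f i ≤ b) → maximum (tabulate f) ≤ b
maximum-≤ {zero}  f le = z≤n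
maximum-≤ {suc n} f le = ℕ.⊔-lub (le zero) (maximum-≤ (f ∘ suc) (le ∘ suc))

maxDegree-maximum : ∀ {n} (G : Graph n) → maxDegree G ≡ maximum (tabulate (degree G))
maxDegree-maximum G = cong maximum (map-tabulate id (degree G))

degree≤maxDegree : ∀ {n} (G : Graph n) u → degree G u ≤ maxDegree G
degree≤maxDegree G u = subst (degree G u ≤_) (≡.sym (maxDegree-maximum G)) (≤-maximum (degree G) u)

≤⌈/2⌉+⌈/2⌉ : ∀ n → n ≤ ⌈ n /2⌉ + ⌈ n /2⌉
≤⌈/2⌉+⌈/2⌉ n = begin
  n                     ≡⟨ ℕ.⌊n/2⌋+⌈n/2⌉≡n n ⟨
  ⌊ n /2⌋ + ⌈ n /2⌉     ≤⟨ ℕ.+-monoˡ-≤ ⌈ n /2⌉ (ℕ.⌊n/2⌋≤⌈n/2⌉ n) ⟩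
  ⌈ n /2⌉ + ⌈ n /2⌉     ∎
  where open ℕ.≤-Reasoning

-- A family of `ω + 1` adjacent vertices would have too large an image; the degree condition is
-- `Δ + ω + 1` being at most twice its rounded-up half.
sparse : ∀ {n ω} (G : Graph n) → P5GemFree G → IsCliqueNumber G ω → Sparse G ω (bound (maxDegree G) ω)
sparse {n} {ω} G free (_ , maximal) = record
  { free = free ; cliques = no-clique ; degrees = degrees′ }
  where
  no-clique : ∀ (f : Fin (suc ω) → Fin n) → ¬ (∀ i j → i ≢ j → Adj G (f i) (f j))
  no-clique f adjf = ℕ.<-irrefl refl (ℕ.≤-trans large (maximal S isClique))
    where
    inImage : Fin n → Bool
    inImage u = does (any? λ i → f i ≟ u)
    S : Subset n
    S = Vec.tabulate inImage
    image : ∀ u → u ∈ S → ∃[ i ] (f i ≡ u)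
    image u u∈S = witness (any? λ i → f i ≟ u)
      (trans (≡.sym (Vec.lookup∘tabulate inImage u)) (Vec.[]=⇒lookup u∈S))
      where
      witness : {A : Set} (A? : Dec A) → does A? ≡ true → A
      witness (yes a) _ = a
    isClique : IsClique G S
    isClique u w u∈S w∈S u≢w with image u u∈S | image w w∈S
    ... | i , refl | j , refl = adjf i j λ { refl → u≢w refl }
    f-injective : Injective _≡_ _≡_ f
    f-injective {i} {j} eq with i ≟ j
    ... | yes e = e
    ... | no ne = ⊥-elim (Adjacency.~-irrefl G (adjf i j ne) eq)
    large : suc ω ≤ ∣ S ∣
    large = subst (suc ω ≤_) (≡.sym (∣tabulate∣ inImage))
      (injection-≤ inImage f f-injective λ i → dec-true (any? λ j → f j ≟ f i) (i , refl))
  degrees′ : ∀ u {m} (f : Fin m → Fin n) → Injective _≡_ _≡_ f → (∀ i → Adj G u (f i)) →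
             m + ω < bound (maxDegree G) ω + bound (maxDegree G) ω
  degrees′ u {m} f inj adjf = begin-strict
    m + ω                    ≤⟨ ℕ.+-monoˡ-≤ ω (injection-≤ (adj G u) f inj adjf) ⟩
    ∑ (bit ∘ adj G u) + ω    ≡⟨ cong (_+ ω) (degree-∑ G u) ⟨
    degree G u + ω           ≤⟨ ℕ.+-monoˡ-≤ ω (degree≤maxDegree G u) ⟩
    maxDegree G + ω          <⟨ ℕ.≤-reflexive (ℕ.+-comm 1 _) ⟩
    maxDegree G + ω + 1      ≤⟨ ≤⌈/2⌉+⌈/2⌉ _ ⟩
    bound (maxDegree G) ω + bound (maxDegree G) ω ∎
    where open ℕ.≤-Reasoning

-- Tightness through complete graphs

complete : ∀ n → Graph n
complete n = record
  { adj   = λ u w → not (does (u ≟ w))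
  ; sym   = λ u w → cong not (does-⇔ (mk⇔ ≡.sym ≡.sym) (u ≟ w) (w ≟ u))
  ; irref = λ u → cong not (dec-true (u ≟ u) refl) }

complete-adj : ∀ {n} {u w : Fin n} → u ≢ w → Adj (complete n) u w
complete-adj {u = u} {w} u≢w = cong not (dec-false (u ≟ w) u≢w)

-- Vertices 0 and 2 are non-adjacent in both patterns.
complete-free : ∀ n → P5GemFree (complete n)
complete-free n = (λ { (f , inj , copy) → apart f inj (copy zero (# 2)) })
                , (λ { (f , inj , copy) → apart f inj (copy zero (# 2)) })
  where
  apart : ∀ (f : Fin 5 → Fin n) → Injective _≡_ _≡_ f → ¬ adj (complete n) (f zero) (f (# 2)) ≡ false
  apart f inj = Adjacency.absurd (complete n) {f zero} {f (# 2)} (complete-adj f₀≢f₂)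
    where
    f₀≢f₂ : f zero ≢ f (# 2)
    f₀≢f₂ eq with () ← inj eq

complete-degree : ∀ n u → ∑ (bit ∘ adj (complete (suc n)) u) ≤ n
complete-degree n zero = ones n
  where
  ones : ∀ n → ∑ {n} (λ _ → 1) ≤ n
  ones zero    = z≤n
  ones (suc n) = s≤s (ones n)
complete-degree (suc n) (suc u) = s≤s (complete-degree n u)

complete-clique : ∀ n → IsCliqueNumber (complete n) n
complete-clique n = (⊤ , (λ _ _ _ _ → complete-adj) , ∣⊤∣≡n n) , λ S _ → ∣p∣≤n S

complete-bound : ∀ n → bound (maxDegree (complete (suc n))) (suc n) ≤ suc n
complete-bound n = begin
  ⌈ maxDegree (complete (suc n)) + suc n + 1 /2⌉
    ≤⟨ ℕ.⌈n/2⌉-mono (ℕ.+-monoˡ-≤ 1 (ℕ.+-monoˡ-≤ (suc n) Δ≤n)) ⟩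
  ⌈ n + suc n + 1 /2⌉
    ≡⟨ cong ⌈_/2⌉ (ℕ.+-comm (n + suc n) 1) ⟩
  ⌈ suc n + suc n /2⌉
    ≡⟨ ℕ.n≡⌈n+n/2⌉ (suc n) ⟨
  suc n ∎
  where
  open ℕ.≤-Reasoning
  Δ≤n : maxDegree (complete (suc n)) ≤ n
  Δ≤n = subst (_≤ n) (≡.sym (maxDegree-maximum (complete (suc n))))
    (maximum-≤ _ λ u → subst (_≤ n) (≡.sym (degree-∑ (complete (suc n)) u)) (complete-degree n u))

-- Colourability is the first half of the theorem. Proper colourings of a complete graph are
-- injective, so fewer than `suc n` colours never suffice.
complete-chromatic : ∀ n →
  IsChromaticNumber (complete (suc n)) (bound (maxDegree (complete (suc n))) (suc n))
complete-chromatic n =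
    sparse-colourable (complete (suc n))
      (sparse (complete (suc n)) (complete-free (suc n)) (complete-clique (suc n)))
  , λ j j<b (c , proper) →
      ℕ.<⇒≱ (ℕ.<-≤-trans j<b (complete-bound n)) (injective⇒≤ (injective c proper))
  where
  injective : ∀ {j} (c : Fin (suc n) → Fin j) →
              ProperColouring (complete (suc n)) j c → Injective _≡_ _≡_ c
  injective c proper {u} {w} eq with u ≟ w
  ... | yes e = e
  ... | no ne = ⊥-elim (proper u w (complete-adj ne) eq)

theorem2 : (∀ (n : ℕ) (G : Graph n) (ω : ℕ) → P5GemFree G → IsCliqueNumber G ω →
    Colourable G (bound (maxDegree G) ω))
    × (∀ (q : ℕ) → 1 ≤ q →
    ∃[ n ] ∃[ G ] (P5GemFree {n} G × IsCliqueNumber G (2 * q)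
    × IsChromaticNumber G (bound (maxDegree G) (2 * q))))
theorem2 = (λ n G ω free clique → sparse-colourable G (sparse G free clique))
  -- The clique on `2 * suc q` vertices; this number reduces to a successor, as `complete-chromatic`
  -- requires.
  , λ { (suc q) _ → 2 * suc q , complete _ , complete-free _ , complete-clique _ , complete-chromatic _ }
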